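{- Let $P[X]=\big\langle\langle Q_{jk}\rangle_j\Rightarrow X\big\rangle_k\Rightarrow X$ be a polynomial type, let $A$ be a $\mathsf{\Lambda2}$-type, let $B\in\mathtt{RS}(A)$, and let $(\mathtt{El},\mathtt{In})_{A\vdash B}$ be a pair of dual contexts. If $\mathtt{El}$ is a morphism between two $P[X]$-algebras $(\Gamma,A,\langle u_k^A\rangle_k)$ and $(\Delta,B,\langle u_k^B\rangle_k)$, then $$\mathtt{Ind}^P_A(\langle u_k^A\rangle_k)\ \simeq_\varepsilon\ \mathtt{In}\big[\mathtt{Ind}^P_B(\langle u_k^B\rangle_k)\big]\ :\ \forall X.P[X]\vdash^{\Delta}A .$$
   Context: $\mathsf{\Lambda2}$ is System F in Church style. $\langle C_i\rangle_i\Rightarrow B$ means $C_1\Rightarrow\dots\Rightarrow C_n\Rightarrow B$, $t\langle u_i\rangle_i$ means $tu_1\dots u_n$, $\lambda\langle x_i\rangle_i.u$ means $\lambda x_1\dots\lambda x_n.u$. $t[x]:A\vdash^\Gamma B$ means $\Gamma,x:A\vdash t:B$; a hole $[\ ]$ plays the role of $x$, and filling a hole may capture variables. **Polynomial types.** $P[X]=\langle\langle Q_{jk}\rangle_j\Rightarrow X\rangle_k\Rightarrow X$ is polynomial if $X$ occurs only positively in all $Q_{jk}$. **Right simplifications.** $\mathtt{RS}(X)=\emptyset$, $\mathtt{RS}(A\Rightarrow B)=\{B\}\cup\mathtt{RS}(B)$, $\mathtt{RS}(\forall Y.B)=\{B\}\cup\mathtt{RS}(B)$. **Dual contexts.** Elimination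 contexts: $\mathtt E::=[\ ]\mid\mathtt EC\mid\mathtt Eu$ ($C$ a type, $u$ a term). Introduction contexts: $\mathtt I::=[\ ]\mid\Lambda Y.\mathtt I\mid\lambda y.\mathtt I$. A pair of dual contexts $(\mathtt{El},\mathtt{In})_{A\vdash B}$ is an elimination context $\mathtt{El}:A\vdash B$ and an introduction context $\mathtt{In}:B\vdash A$ such that $\mathtt{In}[\mathtt{El}]\simeq_\eta[\ ]$. **Algebras.** A $P[X]$-algebra is a triple $(\Gamma,C,\langle u_k\rangle_k)$ of a context $\Gamma$, a type $C$ and terms $u_k[\langle x_j\rangle_j]$ with $\Gamma,\langle x_j:Q_{jk}[C/X]\rangle_j\vdash u_k:C$. A morphism from $(\Gamma,C,\langle u_k\rangle_k)$ to $(\Delta,D,\langle v_k\rangle_k)$ is an inclusion $\Gamma\subseteq\Delta$ together with a term $w[x]:C\vdash^\Delta D$ such that for each $k$, $w[u_k[\langle x_j\rangle_j]]\simeq_{\beta\eta}v_k[\langle\Phi_{Q_{jk}}(w)[x_j]\rangle_j]$ (in context $\Delta,\langle x_j:Q_{jk}[C/X]\rangle_j$). $P[X]$-induction on $C$ is the context $\mathtt{Ind}^P_C(\langle u_k\rangle_k)=[\ ]\,C\,\langle\lambda\langle x_j\rangle_j.u_k[\langle x_j\rangle_j]\rangle_k:\forall X.P[X]\vdash^{\Gamma}C$. **$\varepsilon$-theory.** An occurrence of $X$ is positive/negative if it lies to the left of an even/odd number of arrows. If $X$ occurs only positively in $A$ and $v[x]$ satisfies $\Gamma,x:E\vdash v:F$,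 $\Phi_A(v)[x]$ denotes the functorial action, with $\Gamma,x:A[E/X]\vdash\Phi_A(v)[x]:A[F/X]$; if $X$ occurs only negatively, $\Gamma,x:A[F/X]\vdash\Phi_A(v)[x]:A[E/X]$. Explicitly $\Phi_X(v)=v$, $\Phi_A(v)=x$ if $A$ is a variable other than $X$, $\Phi_{C\Rightarrow D}(v)[x]=\lambda y.\Phi_D(v)[x(\Phi_C(v)[y])]$, $\Phi_{\forall Y.C}(v)[x]=\Lambda Y.\Phi_C(v)[xY]$. The $\varepsilon$-theory is the smallest congruence $\simeq_\varepsilon$ on typed terms containing $\beta\eta$ and closed under: ($\varepsilon^+$) for a type $\forall X.\langle\forall\vec Y_k.\langle A_{jk}\rangle_j\Rightarrow X\rangle_k\Rightarrow B$ with $X$ only positive in the $A_{jk}$ and $B$: if $t$ has this type in $\Gamma$, $e_k:\forall\vec Y_k.\langle A_{jk}[E/X]\rangle_j\Rightarrow E$, $f_k:\forall\vec Y_k.\langle A_{jk}[F/X]\rangle_j\Rightarrow F$, $\Gamma,x:E\vdash v[x]:F$, and for each $k$, $v[e_k\vec Y_k\langle z_j\rangle_j]\simeq f_k\vec Y_k\langle\Phi_{A_{jk}}(v)[z_j]\rangle_j:F$ (for variables $z_j:A_{jk}[E/X]$), then $\Phi_B(v)[tE\langle e_k\rangle_k]\simeq tF\langle f_k\rangle_k:B[F/X]$; ($\varepsilon^-$) for a type $\forall X.\langle\forall\vec Y_j.X\Rightarrow A_j\rangle_j\Rightarrow B$ with $X$ only positive in the $A_j$ and only negative in $B$: if $t$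 has this type in $\Gamma$, $e_j:\forall\vec Y_j.E\Rightarrow A_j[E/X]$, $f_j:\forall\vec Y_j.F\Rightarrow A_j[F/X]$, $\Gamma,x:E\vdash v[x]:F$, and for each $j$, $\Phi_{A_j}(v)[e_j\vec Y_jx]\simeq f_j\vec Y_jv[x]:A_j[F/X]$ (for $x:E$), then $\Phi_B(v)[tF\langle f_j\rangle_j]\simeq tE\langle e_j\rangle_j:B[E/X]$.
   Formalization: The term and type variables bound by In are assumed not to be declared in Γ nor free in P[X] or A (the claim fails if some u_k^A mentions a captured variable); Δ is extended by them only for El and the B-algebra. -}

module Defs where

open import Data.Bool.Base using (if_then_else_)
open import Data.Fin.Base using (Fin; zero; suc)
open import Data.Fin.Properties using (_≟_)
open import Data.Nat.Base using (ℕ; zero; suc)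
open import Data.Sign.Base using (Sign; opposite) renaming (+ to pos; - to neg)
open import Data.Vec.Base using (Vec; []; _∷_; lookup; map; tabulate; zipWith)
import Data.Vec.Functional as F
open import Data.Vec.Relation.Unary.All as All using (All)
open import Data.Vec.Relation.Unary.All.Properties using (map⁺)
open import Function.Base using (_∘_)
open import Function.Definitions using (Injective)
open import Relation.Binary.PropositionalEquality using (_≡_; refl; cong)
open import Relation.Nullary.Decidable.Core using (does)
open import Relation.Nullary.Negation.Core using (¬_)

-- Addition of a telescope of length k to a scope of size n.  The accumulating
-- recursion matches telescopes written outermost binder first, so that no
-- transport along associativity or commutativity of _+_ is ever needed.
infixr 5 _⊹_
_⊹_ : ℕ → ℕ → ℕ
zero  ⊹ n = n
suc k ⊹ n = k ⊹ suc n

variable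
  n n′ m m′ l k : ℕ

raise : ∀ k → Fin n → Fin (k ⊹ n)
raise zero    i = i
raise (suc k) i = raise k (suc i)

-- The variables of a telescope, outermost first.
bound : ∀ k → Vec (Fin (k ⊹ n)) k
bound zero    = []
bound (suc k) = raise k zero ∷ bound k

liftR : (Fin n → Fin n′) → Fin (suc n) → Fin (suc n′)
liftR ρ zero    = zero
liftR ρ (suc i) = suc (ρ i)

liftR* : ∀ k → (Fin n → Fin n′) → Fin (k ⊹ n) → Fin (k ⊹ n′)
liftR* zero    ρ = ρ
liftR* (suc k) ρ = liftR* k (liftR ρ)

-- Ty n: types with n type variables in scope.
infixr 6 _⇒_ _⇒*_
data Ty (n : ℕ) : Set where
  var : Fin n → Ty n
  _⇒_ : Ty n → Ty n → Ty n
  `∀  : Ty (suc n) → Ty n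

_⇒*_ : Vec (Ty n) k → Ty n → Ty n
[]       ⇒* B = B
(C ∷ Cs) ⇒* B = C ⇒ (Cs ⇒* B)

`∀* : ∀ k → Ty (k ⊹ n) → Ty n
`∀* zero    A = A
`∀* (suc k) A = `∀ (`∀* k A)

renT : (Fin n → Fin n′) → Ty n → Ty n′
renT ρ (var X) = var (ρ X)
renT ρ (A ⇒ B) = renT ρ A ⇒ renT ρ B
renT ρ (`∀ A)  = `∀ (renT (liftR ρ) A)

liftT : (Fin n → Ty n′) → Fin (suc n) → Ty (suc n′)
liftT σ = var zero F.∷ (renT suc ∘ σ)

liftT* : ∀ k → (Fin n → Ty n′) → Fin (k ⊹ n) → Ty (k ⊹ n′)
liftT* zero    σ = σ
liftT* (suc k) σ = liftT* k (liftT σ)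

subT : (Fin n → Ty n′) → Ty n → Ty n′
subT σ (var X) = σ X
subT σ (A ⇒ B) = subT σ A ⇒ subT σ B
subT σ (`∀ A)  = `∀ (subT (liftT σ) A)

[_/0] : Ty n → Fin (suc n) → Ty n
[ E /0] = E F.∷ var

infixl 8 _[_]ᵀ
_[_]ᵀ : Ty (suc n) → Ty n → Ty n
A [ E ]ᵀ = subT [ E /0] A

-- Occurrences of a type variable, signed by the parity of the number of
-- arrows to the left of which they lie.
data Occurs : Sign → Fin n → Ty n → Set where
  here  : ∀ {X : Fin n} → Occurs pos X (var X)
  left  : ∀ {s} {X : Fin n} {A B} → Occurs (opposite s) X A → Occurs s X (A ⇒ B)
  right : ∀ {s} {X : Fin n} {A B} → Occurs s X B → Occurs s X (A ⇒ B)
  under : ∀ {s} {X : Fin n} {A} → Occurs s (suc X) A → Occurs s X (`∀ A)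

OnlyPositive OnlyNegative : Fin n → Ty n → Set
OnlyPositive X A = ¬ Occurs neg X A
OnlyNegative X A = ¬ Occurs pos X A

private
  liftR-reflects : {ρ : Fin n → Fin n′} {X : Fin n} {X′ : Fin n′} →
    (∀ i → ρ i ≡ X′ → i ≡ X) → ∀ i → liftR ρ i ≡ suc X′ → i ≡ suc X
  liftR-reflects r (suc i) refl = cong suc (r i refl)

occurs-renT⁻ : ∀ {s} {ρ : Fin n → Fin n′} {X : Fin n} {X′ : Fin n′} (A : Ty n) →
  (∀ i → ρ i ≡ X′ → i ≡ X) → Occurs s X′ (renT ρ A) → Occurs s X A
occurs-renT⁻ (var Y) r here with refl ← r Y refl = here
occurs-renT⁻ (A ⇒ B) r (left o)  = left (occurs-renT⁻ A r o)
occurs-renT⁻ (A ⇒ B) r (right o) = right (occurs-renT⁻ B r o)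
occurs-renT⁻ (`∀ A)  r (under o) = under (occurs-renT⁻ A (liftR-reflects r) o)

-- The scope of a right simplification grows with every quantifier crossed.
infix 4 _∈RS_
data _∈RS_ : Ty n′ → Ty n → Set where
  ⇒-here  : {A B : Ty n} → B ∈RS (A ⇒ B)
  ⇒-there : {C : Ty n′} {A B : Ty n} → C ∈RS B → C ∈RS (A ⇒ B)
  ∀-here  : {B : Ty (suc n)} → B ∈RS `∀ B
  ∀-there : {C : Ty n′} {B : Ty (suc n)} → C ∈RS B → C ∈RS `∀ B

-- Tm n m: terms with n type variables and m term variables in scope.
infixl 7 _·_ _•_ _·*_ _•*_
data Tm (n m : ℕ) : Set where
  `_  : Fin m → Tm n m
  ƛ   : Ty n → Tm n (suc m) → Tm n m
  _·_ : Tm n m → Tm n m → Tm n m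
  Λ   : Tm (suc n) m → Tm n m
  _•_ : Tm n m → Ty n → Tm n m

ƛ* : Vec (Ty n) k → Tm n (k ⊹ m) → Tm n m
ƛ* []       t = t
ƛ* (C ∷ Cs) t = ƛ C (ƛ* Cs t)

_·*_ : Tm n m → Vec (Tm n m) k → Tm n m
t ·* []       = t
t ·* (u ∷ us) = t · u ·* us

_•*_ : Tm n m → Vec (Ty n) k → Tm n m
t •* []       = t
t •* (C ∷ Cs) = t • C •* Cs

ren : (Fin m → Fin m′) → Tm n m → Tm n m′
ren ρ (` i)   = ` ρ i
ren ρ (ƛ C t) = ƛ C (ren (liftR ρ) t)
ren ρ (t · u) = ren ρ t · ren ρ u
ren ρ (Λ t)   = Λ (ren ρ t)
ren ρ (t • C) = ren ρ t • C

renᵗ : (Fin n → Fin n′) → Tm n m → Tm n′ m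
renᵗ ξ (` i)   = ` i
renᵗ ξ (ƛ C t) = ƛ (renT ξ C) (renᵗ ξ t)
renᵗ ξ (t · u) = renᵗ ξ t · renᵗ ξ u
renᵗ ξ (Λ t)   = Λ (renᵗ (liftR ξ) t)
renᵗ ξ (t • C) = renᵗ ξ t • renT ξ C

sub : (Fin m → Tm n m′) → Tm n m → Tm n m′
sub σ (` i)   = σ i
sub σ (ƛ C t) = ƛ C (sub (` zero F.∷ (ren suc ∘ σ)) t)
sub σ (t · u) = sub σ t · sub σ u
sub σ (Λ t)   = Λ (sub (renᵗ suc ∘ σ) t)
sub σ (t • C) = sub σ t • C

subᵗ : (Fin n → Ty n′) → Tm n m → Tm n′ m
subᵗ σ (` i)   = ` i
subᵗ σ (ƛ C t) = ƛ (subT σ C) (subᵗ σ t)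
subᵗ σ (t · u) = subᵗ σ t · subᵗ σ u
subᵗ σ (Λ t)   = Λ (subᵗ (liftT σ) t)
subᵗ σ (t • C) = subᵗ σ t • subT σ C

-- A term w[x] with a distinguished variable is a term whose variable zero
-- is x.
infixl 8 _[_] _[_]ᵗ
_[_] : Tm n (suc m) → Tm n m → Tm n m
w [ t ] = sub (t F.∷ `_) w

_[_]ᵗ : Tm (suc n) m → Ty n → Tm n m
t [ E ]ᵗ = subᵗ [ E /0] t

-- Extension of a substitution to a telescope, outermost variable first.
infixr 5 _∷*_
_∷*_ : Vec (Tm n m′) k → (Fin m → Tm n m′) → Fin (k ⊹ m) → Tm n m′
[]       ∷* σ = σ
(t ∷ ts) ∷* σ = ts ∷* (t F.∷ σ)

Ctx : ℕ → ℕ → Set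
Ctx n m = Vec (Ty n) m

infixl 5 _▸*_
_▸*_ : Ctx n m → Vec (Ty n) k → Ctx n (k ⊹ m)
Γ ▸* []       = Γ
Γ ▸* (C ∷ Cs) = (C ∷ Γ) ▸* Cs

infixl 6 _↑_
_↑_ : Ctx n m → ∀ y → Ctx (y ⊹ n) m
Γ ↑ y = map (renT (raise y)) Γ

infix 4 _⊢_∶_
data _⊢_∶_ {n m} (Γ : Ctx n m) : Tm n m → Ty n → Set where
  var : ∀ i → Γ ⊢ ` i ∶ lookup Γ i
  lam : ∀ {A B t} → A ∷ Γ ⊢ t ∶ B → Γ ⊢ ƛ A t ∶ A ⇒ B
  app : ∀ {A B t u} → Γ ⊢ t ∶ A ⇒ B → Γ ⊢ u ∶ A → Γ ⊢ t · u ∶ B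
  Lam : ∀ {A t} → Γ ↑ 1 ⊢ t ∶ A → Γ ⊢ Λ t ∶ `∀ A
  App : ∀ {A t} → Γ ⊢ t ∶ `∀ A → ∀ C → Γ ⊢ t • C ∶ A [ C ]ᵀ

-- Φ X σ τ A v t is Φ_A(v)[t].  The substitutions σ and τ coincide except at
-- X; they send X to the source and the target type of Φ_A(v) on X.  So, for
-- v : E ⊢ F and X = zero, they are [E/X] and [F/X] when X is only positive
-- in A, and [F/X] and [E/X] when X is only negative in A.  They are needed
-- for the annotations of the abstractions and are exchanged in the domain
-- of an arrow.
Φ : Fin n → (σ τ : Fin n → Ty n′) → Ty n → Tm n′ (suc m) → Tm n′ m → Tm n′ m
Φ X σ τ (var Y) v t = if does (X ≟ Y) then v [ t ] else t
Φ X σ τ (C ⇒ D) v t =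
  ƛ (subT τ C) (Φ X σ τ D v′ (ren suc t · Φ X τ σ C v′ (` zero)))
  where v′ = ren (liftR suc) v
Φ X σ τ (`∀ C)  v t =
  Λ (Φ (suc X) (liftT σ) (liftT τ) C (renᵗ suc v) (renᵗ suc t • var zero))

data Theory : Set where
  η βη ε : Theory

data Hasβ : Theory → Set where
  βη : Hasβ βη
  ε  : Hasβ ε

infix 4 _⊢_≃[_]_∶_
data _⊢_≃[_]_∶_ {n m} (Γ : Ctx n m) : Tm n m → Theory → Tm n m → Ty n → Set where
  ≃-refl  : ∀ {𝒯 t A} → Γ ⊢ t ∶ A → Γ ⊢ t ≃[ 𝒯 ] t ∶ A
  ≃-sym   : ∀ {𝒯 t u A} → Γ ⊢ t ≃[ 𝒯 ] u ∶ A → Γ ⊢ u ≃[ 𝒯 ] t ∶ A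
  ≃-trans : ∀ {𝒯 t u v A} →
    Γ ⊢ t ≃[ 𝒯 ] u ∶ A → Γ ⊢ u ≃[ 𝒯 ] v ∶ A → Γ ⊢ t ≃[ 𝒯 ] v ∶ A

  ƛ-cong : ∀ {𝒯 A B t t′} →
    A ∷ Γ ⊢ t ≃[ 𝒯 ] t′ ∶ B → Γ ⊢ ƛ A t ≃[ 𝒯 ] ƛ A t′ ∶ A ⇒ B
  ·-cong : ∀ {𝒯 A B t t′ u u′} →
    Γ ⊢ t ≃[ 𝒯 ] t′ ∶ A ⇒ B → Γ ⊢ u ≃[ 𝒯 ] u′ ∶ A → Γ ⊢ t · u ≃[ 𝒯 ] t′ · u′ ∶ B
  Λ-cong : ∀ {𝒯 A t t′} →
    Γ ↑ 1 ⊢ t ≃[ 𝒯 ] t′ ∶ A → Γ ⊢ Λ t ≃[ 𝒯 ] Λ t′ ∶ `∀ A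
  •-cong : ∀ {𝒯 A t t′} →
    Γ ⊢ t ≃[ 𝒯 ] t′ ∶ `∀ A → ∀ C → Γ ⊢ t • C ≃[ 𝒯 ] t′ • C ∶ A [ C ]ᵀ

  ⇒-η : ∀ {𝒯 A B t} →
    Γ ⊢ t ∶ A ⇒ B → Γ ⊢ ƛ A (ren suc t · ` zero) ≃[ 𝒯 ] t ∶ A ⇒ B
  ∀-η : ∀ {𝒯 A t} →
    Γ ⊢ t ∶ `∀ A → Γ ⊢ Λ (renᵗ suc t • var zero) ≃[ 𝒯 ] t ∶ `∀ A
  ⇒-β : ∀ {𝒯 A B t u} → Hasβ 𝒯 →
    A ∷ Γ ⊢ t ∶ B → Γ ⊢ u ∶ A → Γ ⊢ ƛ A t · u ≃[ 𝒯 ] t [ u ] ∶ B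
  ∀-β : ∀ {𝒯 A t} → Hasβ 𝒯 →
    Γ ↑ 1 ⊢ t ∶ A → ∀ C → Γ ⊢ Λ t • C ≃[ 𝒯 ] t [ C ]ᵗ ∶ A [ C ]ᵀ

  -- In both rules the k-th clause binds y k type variables; inside it, the
  -- variable X has index raise (y k) zero.
  ε⁺ : ∀ {K} (y J : Fin K → ℕ)
    (A : ∀ k → Vec (Ty (y k ⊹ suc n)) (J k)) (B : Ty (suc n)) {E F : Ty n}
    {t : Tm n m} {e f : Fin K → Tm n m} {v : Tm n (suc m)} →
    (∀ k → All (OnlyPositive (raise (y k) zero)) (A k)) → OnlyPositive zero B →
    let
      _[_/X] : ∀ {k} → Vec (Ty (y k ⊹ suc n)) (J k) → Ty n → Vec (Ty (y k ⊹ n)) (J k)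
      _[_/X] {k} As C = map (subT (liftT* (y k) [ C /0])) As
    in
    Γ ⊢ t ∶ `∀ (tabulate (λ k → `∀* (y k) (A k ⇒* var (raise (y k) zero))) ⇒* B) →
    (∀ k → Γ ⊢ e k ∶ `∀* (y k) (A k [ E /X] ⇒* renT (raise (y k)) E)) →
    (∀ k → Γ ⊢ f k ∶ `∀* (y k) (A k [ F /X] ⇒* renT (raise (y k)) F)) →
    E ∷ Γ ⊢ v ∶ F →
    (∀ k →
      let
        wk  = ren (raise (J k)) ∘ renᵗ (raise (y k))
        v′  = ren (liftR (raise (J k))) (renᵗ (raise (y k)) v)
        Y⃗   = map var (bound (y k))
        z⃗   = map `_ (bound (J k))
        Φv  = λ C z → Φ (raise (y k) zero) (liftT* (y k) [ E /0]) (liftT* (y k) [ F /0]) C v′ z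
      in
      Γ ↑ y k ▸* A k [ E /X]
        ⊢ v′ [ wk (e k) •* Y⃗ ·* z⃗ ] ≃[ ε ] wk (f k) •* Y⃗ ·* zipWith Φv (A k) z⃗
        ∶ renT (raise (y k)) F) →
    Γ ⊢ Φ zero [ E /0] [ F /0] B v (t • E ·* tabulate e) ≃[ ε ] t • F ·* tabulate f
      ∶ B [ F ]ᵀ

  ε⁻ : ∀ {K} (y : Fin K → ℕ)
    (A : ∀ j → Ty (y j ⊹ suc n)) (B : Ty (suc n)) {E F : Ty n}
    {t : Tm n m} {e f : Fin K → Tm n m} {v : Tm n (suc m)} →
    (∀ j → OnlyPositive (raise (y j) zero) (A j)) → OnlyNegative zero B →
    let
      _[_/X] : ∀ {j} → Ty (y j ⊹ suc n) → Ty n → Ty (y j ⊹ n)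
      _[_/X] {j} D C = subT (liftT* (y j) [ C /0]) D
    in
    Γ ⊢ t ∶ `∀ (tabulate (λ j → `∀* (y j) (var (raise (y j) zero) ⇒ A j)) ⇒* B) →
    (∀ j → Γ ⊢ e j ∶ `∀* (y j) (renT (raise (y j)) E ⇒ A j [ E /X])) →
    (∀ j → Γ ⊢ f j ∶ `∀* (y j) (renT (raise (y j)) F ⇒ A j [ F /X])) →
    E ∷ Γ ⊢ v ∶ F →
    (∀ j →
      let
        wk  = ren suc ∘ renᵗ (raise (y j))
        v′  = ren (liftR suc) (renᵗ (raise (y j)) v)
        Y⃗   = map var (bound (y j))
        x   = ` zero
        Φv  = Φ (raise (y j) zero) (liftT* (y j) [ E /0]) (liftT* (y j) [ F /0]) (A j) v′
      in
      renT (raise (y j)) E ∷ Γ ↑ y j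
        ⊢ Φv (wk (e j) •* Y⃗ · x) ≃[ ε ] wk (f j) •* Y⃗ · v′ [ x ]
        ∶ A j [ F /X]) →
    Γ ⊢ Φ zero [ F /0] [ E /0] B v (t • F ·* tabulate f) ≃[ ε ] t • E ·* tabulate e
      ∶ B [ E ]ᵀ

infixl 7 _·ᴱ_ _•ᴱ_ _·*ᴱ_
data Elim (n m : ℕ) : Set where
  □    : Elim n m
  _•ᴱ_ : Elim n m → Ty n → Elim n m
  _·ᴱ_ : Elim n m → Tm n m → Elim n m

_·*ᴱ_ : Elim n m → Vec (Tm n m) k → Elim n m
El ·*ᴱ []       = El
El ·*ᴱ (u ∷ us) = El ·ᴱ u ·*ᴱ us

renᴱ : (Fin m → Fin m′) → Elim n m → Elim n m′
renᴱ ρ □         = □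
renᴱ ρ (El •ᴱ C) = renᴱ ρ El •ᴱ C
renᴱ ρ (El ·ᴱ u) = renᴱ ρ El ·ᴱ ren ρ u

fillᴱ : Elim n m → Tm n m → Tm n m
fillᴱ □         t = t
fillᴱ (El •ᴱ C) t = fillᴱ El t • C
fillᴱ (El ·ᴱ u) t = fillᴱ El t · u

-- El[x], with the hole turned into the variable x.
⟦_⟧ : Elim n m → Tm n (suc m)
⟦ El ⟧ = fillᴱ (renᴱ suc El) (` zero)

-- n′ is the number of type variables in scope at the hole.
data Intro : ℕ → ℕ → Set where
  □ : Intro n n
  Λ : Intro (suc n) n′ → Intro n n′
  ƛ : Ty n → Intro n n′ → Intro n n′

-- The number of term variables in scope at the hole.
infixr 5 _⊹ᴵ_
_⊹ᴵ_ : Intro n n′ → ℕ → ℕ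
□      ⊹ᴵ m = m
Λ In   ⊹ᴵ m = In ⊹ᴵ m
ƛ C In ⊹ᴵ m = In ⊹ᴵ suc m

-- Extension of a context by the variables that In binds.
infixl 5 _▹_
_▹_ : Ctx n m → (In : Intro n n′) → Ctx n′ (In ⊹ᴵ m)
Γ ▹ □      = Γ
Γ ▹ Λ In   = Γ ↑ 1 ▹ In
Γ ▹ ƛ C In = (C ∷ Γ) ▹ In

raiseᵗ : Intro n n′ → Fin n → Fin n′
raiseᵗ □        i = i
raiseᵗ (Λ In)   i = raiseᵗ In (suc i)
raiseᵗ (ƛ C In) i = raiseᵗ In i

raiseᴵ : (In : Intro n n′) → Fin m → Fin (In ⊹ᴵ m)
raiseᴵ □        i = i
raiseᴵ (Λ In)   i = raiseᴵ In i
raiseᴵ (ƛ C In) i = raiseᴵ In (suc i)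

liftᴵ : (In : Intro n n′) → (Fin m → Fin m′) → Fin (In ⊹ᴵ m) → Fin (In ⊹ᴵ m′)
liftᴵ □        ρ = ρ
liftᴵ (Λ In)   ρ = liftᴵ In ρ
liftᴵ (ƛ C In) ρ = liftᴵ In (liftR ρ)

fillᴵ : (In : Intro n n′) → Tm n′ (In ⊹ᴵ m) → Tm n m
fillᴵ □        t = t
fillᴵ (Λ In)   t = Λ (fillᴵ In t)
fillᴵ (ƛ C In) t = ƛ C (fillᴵ In t)

-- In[El[x]], where x lies outside the binders of In and so is not captured.
infix 8 _⟨_⟩
_⟨_⟩ : (In : Intro n n′) → Elim n′ (In ⊹ᴵ m) → Tm n (suc m)
In ⟨ El ⟩ = fillᴵ In (fillᴱ (renᴱ (liftᴵ In suc) El) (` raiseᴵ In zero))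

infix 4 _∶_⊢_
data _∶_⊢_ : Intro n n′ → Ty n′ → Ty n → Set where
  □ : {B : Ty n} → □ ∶ B ⊢ B
  Λ : {In : Intro (suc n) n′} {B : Ty n′} {A : Ty (suc n)} →
      In ∶ B ⊢ A → Λ In ∶ B ⊢ `∀ A
  ƛ : ∀ {C} {In : Intro n n′} {B : Ty n′} {A : Ty n} →
      In ∶ B ⊢ A → ƛ C In ∶ B ⊢ C ⇒ A

-- Δ does not contain the variables captured by In; El lives in Δ extended by
-- them and may mention them.
record Dual (Δ : Ctx n m) (A : Ty n) (B : Ty n′)
            (In : Intro n n′) (El : Elim n′ (In ⊹ᴵ m)) : Set where
  field
    El-typed : renT (raiseᵗ In) A ∷ (Δ ▹ In) ⊢ ⟦ El ⟧ ∶ B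
    In-typed : In ∶ B ⊢ A
    dual     : A ∷ Δ ⊢ In ⟨ El ⟩ ≃[ η ] ` zero ∶ A

-- The type variable X of P[X] has index zero.
record Poly (n : ℕ) : Set where
  field
    {K}      : ℕ
    {J}      : Fin K → ℕ
    Q        : ∀ k → Vec (Ty (suc n)) (J k)
    positive : ∀ k → All (OnlyPositive zero) (Q k)

  _[_/X] : ∀ {k} → Vec (Ty (suc n)) (J k) → Ty n → Vec (Ty n) (J k)
  Qs [ C /X] = map (_[ C ]ᵀ) Qs

  type : Ty (suc n)
  type = tabulate (λ k → Q k ⇒* var zero) ⇒* var zero

renP : (Fin n → Fin n′) → Poly n → Poly n′
renP ξ P = record
  { Q        = map (renT (liftR ξ)) ∘ Q
  ; positive = λ k → map⁺ (All.map (λ {C} p → p ∘ occurs-renT⁻ C reflects) (positive k))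
  }
  where
  open Poly P
  reflects : ∀ i → liftR ξ i ≡ zero → i ≡ zero
  reflects zero _ = refl

record Algebra (P : Poly n) (Γ : Ctx n m) (C : Ty n) : Set where
  open Poly P
  field
    op    : ∀ k → Tm n (J k ⊹ m)
    typed : ∀ k → Γ ▸* Q k [ C /X] ⊢ op k ∶ C

Ind : (P : Poly n) (C : Ty n) → (∀ k → Tm n (Poly.J P k ⊹ m)) → Elim n m
Ind P C u = □ •ᴱ C ·*ᴱ tabulate (λ k → ƛ* (Q k [ C /X]) (u k))
  where open Poly P

-- In a scoped setting an inclusion of contexts also includes the scope of
-- type variables of the first into that of the second.
record IsInclusion (ξ : Fin n → Fin n′) (ρ : Fin m → Fin m′)
                   (Γ : Ctx n m) (Δ : Ctx n′ m′) : Set where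
  field
    ξ-injective : Injective _≡_ _≡_ ξ
    ρ-injective : Injective _≡_ _≡_ ρ
    preserves   : ∀ i → lookup Δ (ρ i) ≡ renT ξ (lookup Γ i)

record IsMorphism (ξ : Fin n → Fin n′) (ρ : Fin m → Fin m′) {P : Poly n}
                  {Γ : Ctx n m} {C : Ty n} (𝒜 : Algebra P Γ C)
                  {Δ : Ctx n′ m′} {D : Ty n′} (ℬ : Algebra (renP ξ P) Δ D)
                  (w : Tm n′ (suc m′)) : Set where
  private
    module 𝒜 = Algebra 𝒜
    module ℬ = Algebra ℬ
    C′ = renT ξ C
  open Poly (renP ξ P)
  field
    inclusion : IsInclusion ξ ρ Γ Δ
    typed     : C′ ∷ Δ ⊢ w ∶ D
    commutes  : ∀ k →
      let
        u   = ren (liftR* (J k) ρ) (renᵗ ξ (𝒜.op k))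
        v   = ℬ.op k
        w′  = ren (liftR (raise (J k))) w
        Φw  = λ A x → Φ zero [ C′ /0] [ D /0] A w′ x
      in
      Δ ▸* Q k [ C′ /X]
        ⊢ w′ [ u ] ≃[ βη ] sub (zipWith Φw (Q k) (map `_ (bound (J k))) ∷* (`_ ∘ raise (J k))) v
        ∶ D

{-# OPTIONS --safe #-}
module Submission where

-- For any morphism w of P[X]-algebras, w[Ind_C] ≃ε Ind_D is the instance of
-- (ε⁺) at B = X, applied to the variable x : ∀X.P[X]; the β-rule turns its
-- premises into the morphism condition.  For w = El this gives
-- In[El[Ind_A]] ≃ε In[Ind_B], and duality collapses the left-hand side to Ind_A.
-- As x is not in Δ, the hypotheses, which are βη- and η-equations, must first be
-- weakened.

open import Data.Empty using (⊥-elim)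
open import Data.Fin.Base using (Fin; zero; suc)
open import Data.Fin.Properties using (_≟_; suc-injective)
open import Data.Nat.Base using (ℕ; zero; suc)
open import Data.Product.Base using (_×_; _,_)
open import Data.Vec.Base using (Vec; []; _∷_; length; lookup; map; tabulate; zipWith)
import Data.Vec.Functional as F
open import Data.Vec.Properties
  using (lookup-map; map-∘; map-cong; map-id; tabulate-∘; tabulate-cong)
open import Data.Vec.Relation.Unary.All using (All; []; _∷_)
open import Data.Vec.Relation.Binary.Pointwise.Inductive as PW using (Pointwise; []; _∷_)
open import Function.Base using (_∘_; id)
open import Function.Definitions using (Injective)
open import Relation.Binary.PropositionalEquality
  using (_≡_; _≢_; _≗_; refl; sym; trans; cong; cong₂; subst)
open import Relation.Nullary using (yes; no)
open import Defs

-- Fusion does not take place in the context of the conclusion but under the binders of `In`, where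
-- `El` lives and may mention the captured variables. The source algebra is therefore needed twice:
-- outside `In`, to form the induction on `A` that duality collapses, and inside `In`, weakened in
-- type and term variables, as the source of the morphism `El`. Much of the calculus of renamings
-- serves to show that the two copies agree once the outer one is pushed under `In`.
--
-- Equations are typed judgements, and no typing is ever extracted from them. The β-rules and
-- congruences thus require separate typings of `Φ`, of folds and of filled contexts.

private variable
  n₁ n₂ m₁ m₂ : ℕ
  𝒯 : Theory

-- Types

-- Renamings and substitutions are functions, and without function extensionality going under a
-- binder preserves only pointwise equality. The laws below therefore take and give `≗`.
liftR-cong : {ρ ρ′ : Fin n → Fin n′} → ρ ≗ ρ′ → liftR ρ ≗ liftR ρ′
liftR-cong e zero    = refl
liftR-cong e (suc i) = cong suc (e i)

liftR-id : {ρ : Fin n → Fin n} → ρ ≗ id → liftR ρ ≗ id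
liftR-id e zero    = refl
liftR-id e (suc i) = cong suc (e i)

liftR-∘ : (ρ : Fin n₁ → Fin n₂) (ρ′ : Fin n → Fin n₁) →
  liftR ρ ∘ liftR ρ′ ≗ liftR (ρ ∘ ρ′)
liftR-∘ ρ ρ′ zero    = refl
liftR-∘ ρ ρ′ (suc i) = refl

renT-cong : {ρ ρ′ : Fin n → Fin n′} → ρ ≗ ρ′ → renT ρ ≗ renT ρ′
renT-cong e (var X) = cong var (e X)
renT-cong e (A ⇒ B) = cong₂ _⇒_ (renT-cong e A) (renT-cong e B)
renT-cong e (`∀ A)  = cong `∀ (renT-cong (liftR-cong e) A)

renT-id : {ρ : Fin n → Fin n} → ρ ≗ id → renT ρ ≗ id
renT-id e (var X) = cong var (e X)
renT-id e (A ⇒ B) = cong₂ _⇒_ (renT-id e A) (renT-id e B)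
renT-id e (`∀ A)  = cong `∀ (renT-id (liftR-id e) A)

renT-∘ : (ρ : Fin n₁ → Fin n₂) (ρ′ : Fin n → Fin n₁) → renT ρ ∘ renT ρ′ ≗ renT (ρ ∘ ρ′)
renT-∘ ρ ρ′ (var X) = refl
renT-∘ ρ ρ′ (A ⇒ B) = cong₂ _⇒_ (renT-∘ ρ ρ′ A) (renT-∘ ρ ρ′ B)
renT-∘ ρ ρ′ (`∀ A)  =
  cong `∀ (trans (renT-∘ (liftR ρ) (liftR ρ′) A) (renT-cong (liftR-∘ ρ ρ′) A))

renT-liftR-suc : (ρ : Fin n → Fin n′) → renT (liftR ρ) ∘ renT suc ≗ renT suc ∘ renT ρ
renT-liftR-suc ρ A = trans (renT-∘ (liftR ρ) suc A) (sym (renT-∘ suc ρ A))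

liftR-injective : {ρ : Fin n → Fin n′} → Injective _≡_ _≡_ ρ → Injective _≡_ _≡_ (liftR ρ)
liftR-injective inj {zero}  {zero}  e = refl
liftR-injective inj {suc i} {suc j} e = cong suc (inj (suc-injective e))

var-injective : {X Y : Fin n} → Ty.var X ≡ Ty.var Y → X ≡ Y
var-injective refl = refl

⇒-injective : {A A′ B B′ : Ty n} → A ⇒ B ≡ A′ ⇒ B′ → A ≡ A′ × B ≡ B′
⇒-injective refl = refl , refl

`∀-injective : {A B : Ty (suc n)} → `∀ A ≡ `∀ B → A ≡ B
`∀-injective refl = refl

-- Lets an equation between types of variables that is known under the binders of `In` be read back
-- outside them.
renT-injective : {ρ : Fin n → Fin n′} → Injective _≡_ _≡_ ρ → Injective _≡_ _≡_ (renT ρ)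
renT-injective inj {var X} {var Y} e = cong var (inj (var-injective e))
renT-injective inj {A ⇒ B} {A′ ⇒ B′} e with ⇒-injective e
... | e₁ , e₂ = cong₂ _⇒_ (renT-injective inj e₁) (renT-injective inj e₂)
renT-injective inj {`∀ A} {`∀ B} e =
  cong `∀ (renT-injective (liftR-injective inj) (`∀-injective e))

liftT-cong : {σ τ : Fin n → Ty n′} → σ ≗ τ → liftT σ ≗ liftT τ
liftT-cong e zero    = refl
liftT-cong e (suc i) = cong (renT suc) (e i)

subT-cong : {σ τ : Fin n → Ty n′} → σ ≗ τ → subT σ ≗ subT τ
subT-cong e (var X) = e X
subT-cong e (A ⇒ B) = cong₂ _⇒_ (subT-cong e A) (subT-cong e B)
subT-cong e (`∀ A)  = cong `∀ (subT-cong (liftT-cong e) A)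

subT-id : {σ : Fin n → Ty n} → σ ≗ var → subT σ ≗ id
subT-id e (var X) = e X
subT-id e (A ⇒ B) = cong₂ _⇒_ (subT-id e A) (subT-id e B)
subT-id e (`∀ A)  = cong `∀ (subT-id lift-e A)
  where
  lift-e : liftT _ ≗ var
  lift-e zero    = refl
  lift-e (suc i) = cong (renT suc) (e i)

renT-subT : (ρ : Fin n₁ → Fin n₂) (σ : Fin n → Ty n₁) → renT ρ ∘ subT σ ≗ subT (renT ρ ∘ σ)
renT-subT ρ σ (var X) = refl
renT-subT ρ σ (A ⇒ B) = cong₂ _⇒_ (renT-subT ρ σ A) (renT-subT ρ σ B)
renT-subT ρ σ (`∀ A)  =
  cong `∀ (trans (renT-subT (liftR ρ) (liftT σ) A) (subT-cong lift-∘ A))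
  where
  lift-∘ : renT (liftR ρ) ∘ liftT σ ≗ liftT (renT ρ ∘ σ)
  lift-∘ zero    = refl
  lift-∘ (suc i) = renT-liftR-suc ρ (σ i)

subT-renT : (σ : Fin n₁ → Ty n₂) (ρ : Fin n → Fin n₁) → subT σ ∘ renT ρ ≗ subT (σ ∘ ρ)
subT-renT σ ρ (var X) = refl
subT-renT σ ρ (A ⇒ B) = cong₂ _⇒_ (subT-renT σ ρ A) (subT-renT σ ρ B)
subT-renT σ ρ (`∀ A)  =
  cong `∀ (trans (subT-renT (liftT σ) (liftR ρ) A) (subT-cong lift-∘ A))
  where
  lift-∘ : liftT σ ∘ liftR ρ ≗ liftT (σ ∘ ρ)
  lift-∘ zero    = refl
  lift-∘ (suc i) = refl

renT-[]ᵀ : (ρ : Fin n → Fin n′) (A : Ty (suc n)) (C : Ty n) →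
  renT ρ (A [ C ]ᵀ) ≡ renT (liftR ρ) A [ renT ρ C ]ᵀ
renT-[]ᵀ ρ A C =
  trans (renT-subT ρ [ C /0] A)
    (trans (subT-cong pointwise A) (sym (subT-renT [ renT ρ C /0] (liftR ρ) A)))
  where
  pointwise : renT ρ ∘ [ C /0] ≗ [ renT ρ C /0] ∘ liftR ρ
  pointwise zero    = refl
  pointwise (suc i) = refl

-- Needed for the quantifier case of `Φ`, whose recursive argument is a weakened term applied to the
-- fresh type variable.
renT-liftR-suc-[]ᵀ : (A : Ty (suc n)) → renT (liftR suc) A [ var zero ]ᵀ ≡ A
renT-liftR-suc-[]ᵀ A = trans (subT-renT [ var zero /0] (liftR suc) A) (subT-id pointwise A)
  where
  pointwise : [ var zero /0] ∘ liftR suc ≗ var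
  pointwise zero    = refl
  pointwise (suc i) = refl

renT-⇒* : (ρ : Fin n → Fin n′) (As : Vec (Ty n) k) (B : Ty n) →
  renT ρ (As ⇒* B) ≡ map (renT ρ) As ⇒* renT ρ B
renT-⇒* ρ []       B = refl
renT-⇒* ρ (A ∷ As) B = cong (renT ρ A ⇒_) (renT-⇒* ρ As B)

subT-⇒* : (σ : Fin n → Ty n′) (As : Vec (Ty n) k) (B : Ty n) →
  subT σ (As ⇒* B) ≡ map (subT σ) As ⇒* subT σ B
subT-⇒* σ []       B = refl
subT-⇒* σ (A ∷ As) B = cong (subT σ A ⇒_) (subT-⇒* σ As B)

-- Terms

liftS : (Fin m → Tm n m′) → Fin (suc m) → Tm n (suc m′)
liftS σ = ` zero F.∷ (ren suc ∘ σ)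

ren-cong : {ρ ρ′ : Fin m → Fin m′} → ρ ≗ ρ′ → (t : Tm n m) → ren ρ t ≡ ren ρ′ t
ren-cong e (` i)   = cong `_ (e i)
ren-cong e (ƛ C t) = cong (ƛ C) (ren-cong (liftR-cong e) t)
ren-cong e (t · u) = cong₂ _·_ (ren-cong e t) (ren-cong e u)
ren-cong e (Λ t)   = cong Λ (ren-cong e t)
ren-cong e (t • C) = cong (_• C) (ren-cong e t)

ren-∘ : (ρ : Fin m₁ → Fin m₂) (ρ′ : Fin m → Fin m₁) (t : Tm n m) →
  ren ρ (ren ρ′ t) ≡ ren (ρ ∘ ρ′) t
ren-∘ ρ ρ′ (` i)   = refl
ren-∘ ρ ρ′ (ƛ C t) =
  cong (ƛ C) (trans (ren-∘ (liftR ρ) (liftR ρ′) t) (ren-cong (liftR-∘ ρ ρ′) t))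
ren-∘ ρ ρ′ (t · u) = cong₂ _·_ (ren-∘ ρ ρ′ t) (ren-∘ ρ ρ′ u)
ren-∘ ρ ρ′ (Λ t)   = cong Λ (ren-∘ ρ ρ′ t)
ren-∘ ρ ρ′ (t • C) = cong (_• C) (ren-∘ ρ ρ′ t)

-- A square rather than a composite, because the typical use exchanges a weakening with a lifted
-- renaming; there the hypothesis often holds by computation.
ren-square : {ρ₁ : Fin m₁ → Fin m′} {ρ₂ : Fin m → Fin m₁}
  {ρ₃ : Fin m₂ → Fin m′} {ρ₄ : Fin m → Fin m₂} →
  ρ₁ ∘ ρ₂ ≗ ρ₃ ∘ ρ₄ → (t : Tm n m) → ren ρ₁ (ren ρ₂ t) ≡ ren ρ₃ (ren ρ₄ t)
ren-square {ρ₁ = ρ₁} {ρ₂} {ρ₃} {ρ₄} e t =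
  trans (ren-∘ ρ₁ ρ₂ t) (trans (ren-cong e t) (sym (ren-∘ ρ₃ ρ₄ t)))

liftR-square : {ρ₁ : Fin m₁ → Fin m′} {ρ₂ : Fin m → Fin m₁}
  {ρ₃ : Fin m₂ → Fin m′} {ρ₄ : Fin m → Fin m₂} →
  ρ₁ ∘ ρ₂ ≗ ρ₃ ∘ ρ₄ → liftR ρ₁ ∘ liftR ρ₂ ≗ liftR ρ₃ ∘ liftR ρ₄
liftR-square e zero    = refl
liftR-square e (suc i) = cong suc (e i)

renᵗ-cong : {ξ ξ′ : Fin n → Fin n′} → ξ ≗ ξ′ → (t : Tm n m) → renᵗ ξ t ≡ renᵗ ξ′ t
renᵗ-cong e (` i)   = refl
renᵗ-cong e (ƛ C t) = cong₂ ƛ (renT-cong e C) (renᵗ-cong e t)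
renᵗ-cong e (t · u) = cong₂ _·_ (renᵗ-cong e t) (renᵗ-cong e u)
renᵗ-cong e (Λ t)   = cong Λ (renᵗ-cong (liftR-cong e) t)
renᵗ-cong e (t • C) = cong₂ _•_ (renᵗ-cong e t) (renT-cong e C)

renᵗ-id : {ξ : Fin n → Fin n} → ξ ≗ id → (t : Tm n m) → renᵗ ξ t ≡ t
renᵗ-id e (` i)   = refl
renᵗ-id e (ƛ C t) = cong₂ ƛ (renT-id e C) (renᵗ-id e t)
renᵗ-id e (t · u) = cong₂ _·_ (renᵗ-id e t) (renᵗ-id e u)
renᵗ-id e (Λ t)   = cong Λ (renᵗ-id (liftR-id e) t)
renᵗ-id e (t • C) = cong₂ _•_ (renᵗ-id e t) (renT-id e C)

renᵗ-∘ : (ξ : Fin n₁ → Fin n₂) (ξ′ : Fin n → Fin n₁) (t : Tm n m) →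
  renᵗ ξ (renᵗ ξ′ t) ≡ renᵗ (ξ ∘ ξ′) t
renᵗ-∘ ξ ξ′ (` i)   = refl
renᵗ-∘ ξ ξ′ (ƛ C t) = cong₂ ƛ (renT-∘ ξ ξ′ C) (renᵗ-∘ ξ ξ′ t)
renᵗ-∘ ξ ξ′ (t · u) = cong₂ _·_ (renᵗ-∘ ξ ξ′ t) (renᵗ-∘ ξ ξ′ u)
renᵗ-∘ ξ ξ′ (Λ t)   =
  cong Λ (trans (renᵗ-∘ (liftR ξ) (liftR ξ′) t) (renᵗ-cong (liftR-∘ ξ ξ′) t))
renᵗ-∘ ξ ξ′ (t • C) = cong₂ _•_ (renᵗ-∘ ξ ξ′ t) (renT-∘ ξ ξ′ C)

ren-renᵗ : (ρ : Fin m → Fin m′) (ξ : Fin n → Fin n′) (t : Tm n m) →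
  ren ρ (renᵗ ξ t) ≡ renᵗ ξ (ren ρ t)
ren-renᵗ ρ ξ (` i)   = refl
ren-renᵗ ρ ξ (ƛ C t) = cong (ƛ (renT ξ C)) (ren-renᵗ (liftR ρ) ξ t)
ren-renᵗ ρ ξ (t · u) = cong₂ _·_ (ren-renᵗ ρ ξ t) (ren-renᵗ ρ ξ u)
ren-renᵗ ρ ξ (Λ t)   = cong Λ (ren-renᵗ ρ (liftR ξ) t)
ren-renᵗ ρ ξ (t • C) = cong (_• renT ξ C) (ren-renᵗ ρ ξ t)

ren-subᵗ : (ρ : Fin m → Fin m′) (σ : Fin n → Ty n′) (t : Tm n m) →
  ren ρ (subᵗ σ t) ≡ subᵗ σ (ren ρ t)
ren-subᵗ ρ σ (` i)   = refl
ren-subᵗ ρ σ (ƛ C t) = cong (ƛ (subT σ C)) (ren-subᵗ (liftR ρ) σ t)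
ren-subᵗ ρ σ (t · u) = cong₂ _·_ (ren-subᵗ ρ σ t) (ren-subᵗ ρ σ u)
ren-subᵗ ρ σ (Λ t)   = cong Λ (ren-subᵗ ρ (liftT σ) t)
ren-subᵗ ρ σ (t • C) = cong (_• subT σ C) (ren-subᵗ ρ σ t)

liftS-cong : {σ τ : Fin m → Tm n m′} → σ ≗ τ → liftS σ ≗ liftS τ
liftS-cong e zero    = refl
liftS-cong e (suc i) = cong (ren suc) (e i)

sub-cong : {σ τ : Fin m → Tm n m′} → σ ≗ τ → sub σ ≗ sub τ
sub-cong e (` i)   = e i
sub-cong e (ƛ C t) = cong (ƛ C) (sub-cong (liftS-cong e) t)
sub-cong e (t · u) = cong₂ _·_ (sub-cong e t) (sub-cong e u)
sub-cong e (Λ t)   = cong Λ (sub-cong (cong (renᵗ suc) ∘ e) t)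
sub-cong e (t • C) = cong (_• C) (sub-cong e t)

sub-renaming : {σ : Fin m → Tm n m′} (ρ : Fin m → Fin m′) → σ ≗ `_ ∘ ρ → sub σ ≗ ren ρ
sub-renaming ρ e (` i)   = e i
sub-renaming ρ e (ƛ C t) = cong (ƛ C) (sub-renaming (liftR ρ) lift-e t)
  where
  lift-e : liftS _ ≗ `_ ∘ liftR ρ
  lift-e zero    = refl
  lift-e (suc i) = cong (ren suc) (e i)
sub-renaming ρ e (t · u) = cong₂ _·_ (sub-renaming ρ e t) (sub-renaming ρ e u)
sub-renaming ρ e (Λ t)   = cong Λ (sub-renaming ρ (cong (renᵗ suc) ∘ e) t)
sub-renaming ρ e (t • C) = cong (_• C) (sub-renaming ρ e t)

ren-id : {ρ : Fin m → Fin m} → ρ ≗ id → (t : Tm n m) → ren ρ t ≡ t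
ren-id e (` i)   = cong `_ (e i)
ren-id e (ƛ C t) = cong (ƛ C) (ren-id (liftR-id e) t)
ren-id e (t · u) = cong₂ _·_ (ren-id e t) (ren-id e u)
ren-id e (Λ t)   = cong Λ (ren-id e t)
ren-id e (t • C) = cong (_• C) (ren-id e t)

sub-id : {σ : Fin m → Tm n m} → σ ≗ `_ → sub σ ≗ id
sub-id e t = trans (sub-renaming id e t) (ren-id (λ _ → refl) t)

sub-ren : (σ : Fin m₁ → Tm n m₂) (ρ : Fin m → Fin m₁) (t : Tm n m) →
  sub σ (ren ρ t) ≡ sub (σ ∘ ρ) t
sub-ren σ ρ (` i)   = refl
sub-ren σ ρ (ƛ C t) =
  cong (ƛ C) (trans (sub-ren (liftS σ) (liftR ρ) t) (sub-cong lift-∘ t))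
  where
  lift-∘ : liftS σ ∘ liftR ρ ≗ liftS (σ ∘ ρ)
  lift-∘ zero    = refl
  lift-∘ (suc i) = refl
sub-ren σ ρ (t · u) = cong₂ _·_ (sub-ren σ ρ t) (sub-ren σ ρ u)
sub-ren σ ρ (Λ t)   = cong Λ (sub-ren (renᵗ suc ∘ σ) ρ t)
sub-ren σ ρ (t • C) = cong (_• C) (sub-ren σ ρ t)

ren-sub : (ρ : Fin m₁ → Fin m₂) (σ : Fin m → Tm n m₁) (t : Tm n m) →
  ren ρ (sub σ t) ≡ sub (ren ρ ∘ σ) t
ren-sub ρ σ (` i)   = refl
ren-sub ρ σ (ƛ C t) =
  cong (ƛ C) (trans (ren-sub (liftR ρ) (liftS σ) t) (sub-cong lift-∘ t))
  where
  lift-∘ : ren (liftR ρ) ∘ liftS σ ≗ liftS (ren ρ ∘ σ)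
  lift-∘ zero    = refl
  lift-∘ (suc i) = ren-square (λ _ → refl) (σ i)
ren-sub ρ σ (t · u) = cong₂ _·_ (ren-sub ρ σ t) (ren-sub ρ σ u)
ren-sub ρ σ (Λ t)   =
  cong Λ (trans (ren-sub ρ (renᵗ suc ∘ σ) t) (sub-cong (ren-renᵗ ρ suc ∘ σ) t))
ren-sub ρ σ (t • C) = cong (_• C) (ren-sub ρ σ t)

renᵗ-liftR-suc : (ξ : Fin n → Fin n′) (t : Tm n m) →
  renᵗ (liftR ξ) (renᵗ suc t) ≡ renᵗ suc (renᵗ ξ t)
renᵗ-liftR-suc ξ t = trans (renᵗ-∘ (liftR ξ) suc t) (sym (renᵗ-∘ suc ξ t))

-- A type abstraction makes `sub` weaken its entries in the type variables, so composing
-- substitutions under it requires this exchange.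
renᵗ-sub : (ξ : Fin n → Fin n′) (σ : Fin m → Tm n m′) (t : Tm n m) →
  renᵗ ξ (sub σ t) ≡ sub (renᵗ ξ ∘ σ) (renᵗ ξ t)
renᵗ-sub ξ σ (` i)   = refl
renᵗ-sub ξ σ (ƛ C t) =
  cong (ƛ (renT ξ C)) (trans (renᵗ-sub ξ (liftS σ) t) (sub-cong lift-∘ (renᵗ ξ t)))
  where
  lift-∘ : renᵗ ξ ∘ liftS σ ≗ liftS (renᵗ ξ ∘ σ)
  lift-∘ zero    = refl
  lift-∘ (suc i) = sym (ren-renᵗ suc ξ (σ i))
renᵗ-sub ξ σ (t · u) = cong₂ _·_ (renᵗ-sub ξ σ t) (renᵗ-sub ξ σ u)
renᵗ-sub ξ σ (Λ t)   =
  cong Λ (trans (renᵗ-sub (liftR ξ) (renᵗ suc ∘ σ) t)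
    (sub-cong (renᵗ-liftR-suc ξ ∘ σ) (renᵗ (liftR ξ) t)))
renᵗ-sub ξ σ (t • C) = cong (_• renT ξ C) (renᵗ-sub ξ σ t)

sub-∘ : (σ : Fin m₁ → Tm n m₂) (τ : Fin m → Tm n m₁) (t : Tm n m) →
  sub σ (sub τ t) ≡ sub (sub σ ∘ τ) t
sub-∘ σ τ (` i)   = refl
sub-∘ σ τ (ƛ C t) =
  cong (ƛ C) (trans (sub-∘ (liftS σ) (liftS τ) t) (sub-cong lift-∘ t))
  where
  lift-∘ : sub (liftS σ) ∘ liftS τ ≗ liftS (sub σ ∘ τ)
  lift-∘ zero    = refl
  lift-∘ (suc i) = trans (sub-ren (liftS σ) suc (τ i)) (sym (ren-sub suc σ (τ i)))
sub-∘ σ τ (t · u) = cong₂ _·_ (sub-∘ σ τ t) (sub-∘ σ τ u)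
sub-∘ σ τ (Λ t)   =
  cong Λ (trans (sub-∘ (renᵗ suc ∘ σ) (renᵗ suc ∘ τ) t)
    (sub-cong (λ i → sym (renᵗ-sub suc σ (τ i))) t))
sub-∘ σ τ (t • C) = cong (_• C) (sub-∘ σ τ t)

-- One step of iterated β: contracting a redex whose abstraction already carries a substitution
-- merely extends that substitution.
liftS-[] : (σ : Fin m → Tm n m′) (s : Tm n (suc m)) (t : Tm n m′) →
  sub (liftS σ) s [ t ] ≡ sub (t F.∷ σ) s
liftS-[] σ s t = trans (sub-∘ (t F.∷ `_) (liftS σ) s) (sub-cong pointwise s)
  where
  pointwise : sub (t F.∷ `_) ∘ liftS σ ≗ t F.∷ σ
  pointwise zero    = refl
  pointwise (suc i) = trans (sub-ren (t F.∷ `_) suc (σ i)) (sub-id (λ _ → refl) (σ i))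

ren-liftR-[] : (ρ : Fin m → Fin m′) (s : Tm n (suc m)) (t : Tm n m′) →
  ren (liftR ρ) s [ t ] ≡ sub (t F.∷ (`_ ∘ ρ)) s
ren-liftR-[] ρ s t = trans (sub-ren (t F.∷ `_) (liftR ρ) s) (sub-cong pointwise s)
  where
  pointwise : (t F.∷ `_) ∘ liftR ρ ≗ t F.∷ (`_ ∘ ρ)
  pointwise zero    = refl
  pointwise (suc i) = refl

ren-[] : (ρ : Fin m → Fin m′) (s : Tm n (suc m)) (t : Tm n m) →
  ren ρ (s [ t ]) ≡ ren (liftR ρ) s [ ren ρ t ]
ren-[] ρ s t =
  trans (ren-sub ρ (t F.∷ `_) s)
    (trans (sub-cong pointwise s) (sym (ren-liftR-[] ρ s (ren ρ t))))
  where
  pointwise : ren ρ ∘ (t F.∷ `_) ≗ ren ρ t F.∷ (`_ ∘ ρ)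
  pointwise zero    = refl
  pointwise (suc i) = refl

-- The recursion of `Φ` is driven by the type alone, and term variables enter only through `v` and
-- `t`. Both substitutions are arbitrary because the arrow case exchanges them.
ren-Φ : ∀ (ρ : Fin m → Fin m′) (X : Fin n) (σ τ : Fin n → Ty n′) A v (t : Tm n′ m) →
  ren ρ (Φ X σ τ A v t) ≡ Φ X σ τ A (ren (liftR ρ) v) (ren ρ t)
ren-Φ ρ X σ τ (var Y) v t with X ≟ Y
... | yes _ = ren-[] ρ v t
... | no  _ = refl
ren-Φ ρ X σ τ (C ⇒ D) v t =
  cong (ƛ (subT τ C))
    (trans (ren-Φ (liftR ρ) X σ τ D _ _)
      (cong₂ (Φ X σ τ D) v-eq
        (cong₂ _·_ (ren-square (λ _ → refl) t)
          (trans (ren-Φ (liftR ρ) X τ σ C _ _) (cong (λ v → Φ X τ σ C v (` zero)) v-eq)))))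
  where
  v-eq : ren (liftR (liftR ρ)) (ren (liftR suc) v) ≡ ren (liftR suc) (ren (liftR ρ) v)
  v-eq = ren-square (liftR-square (λ _ → refl)) v
ren-Φ ρ X σ τ (`∀ C) v t =
  cong Λ
    (trans (ren-Φ ρ (suc X) (liftT σ) (liftT τ) C _ _)
      (cong₂ (λ v t → Φ (suc X) (liftT σ) (liftT τ) C v (t • var zero))
        (ren-renᵗ (liftR ρ) suc v) (ren-renᵗ ρ suc t)))

-- Telescopes

liftR*-cong : ∀ k {ρ ρ′ : Fin n → Fin n′} → ρ ≗ ρ′ → liftR* k ρ ≗ liftR* k ρ′
liftR*-cong zero    e = e
liftR*-cong (suc k) e = liftR*-cong k (liftR-cong e)

liftR*-∘ : ∀ k (ρ : Fin m₁ → Fin m₂) (ρ′ : Fin m → Fin m₁) →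
  liftR* k ρ ∘ liftR* k ρ′ ≗ liftR* k (ρ ∘ ρ′)
liftR*-∘ zero    ρ ρ′ i = refl
liftR*-∘ (suc k) ρ ρ′ i =
  trans (liftR*-∘ k (liftR ρ) (liftR ρ′) i) (liftR*-cong k (liftR-∘ ρ ρ′) i)

liftR*-raise : ∀ k (ρ : Fin n → Fin n′) → liftR* k ρ ∘ raise k ≗ raise k ∘ ρ
liftR*-raise zero    ρ i = refl
liftR*-raise (suc k) ρ i = liftR*-raise k (liftR ρ) (suc i)

map-liftR*-bound : ∀ k (ρ : Fin n → Fin n′) → map (liftR* k ρ) (bound k) ≡ bound k
map-liftR*-bound zero    ρ = refl
map-liftR*-bound (suc k) ρ =
  cong₂ _∷_ (liftR*-raise k (liftR ρ) zero) (map-liftR*-bound k (liftR ρ))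

ren-ƛ* : (ρ : Fin m → Fin m′) (Cs : Vec (Ty n) k) (u : Tm n (k ⊹ m)) →
  ren ρ (ƛ* Cs u) ≡ ƛ* Cs (ren (liftR* k ρ) u)
ren-ƛ* ρ []       u = refl
ren-ƛ* ρ (C ∷ Cs) u = cong (ƛ C) (ren-ƛ* (liftR ρ) Cs u)

renᵗ-ƛ* : (ξ : Fin n → Fin n′) (Cs : Vec (Ty n) k) (u : Tm n (k ⊹ m)) →
  renᵗ ξ (ƛ* Cs u) ≡ ƛ* (map (renT ξ) Cs) (renᵗ ξ u)
renᵗ-ƛ* ξ []       u = refl
renᵗ-ƛ* ξ (C ∷ Cs) u = cong (ƛ (renT ξ C)) (renᵗ-ƛ* ξ Cs u)

ren-·* : (ρ : Fin m → Fin m′) (t : Tm n m) (us : Vec (Tm n m) k) →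
  ren ρ (t ·* us) ≡ ren ρ t ·* map (ren ρ) us
ren-·* ρ t []       = refl
ren-·* ρ t (u ∷ us) = ren-·* ρ (t · u) us

renᵗ-·* : (ξ : Fin n → Fin n′) (t : Tm n m) (us : Vec (Tm n m) k) →
  renᵗ ξ (t ·* us) ≡ renᵗ ξ t ·* map (renᵗ ξ) us
renᵗ-·* ξ t []       = refl
renᵗ-·* ξ t (u ∷ us) = renᵗ-·* ξ (t · u) us

∷*-cong : (ts : Vec (Tm n m′) k) {σ τ : Fin m → Tm n m′} → σ ≗ τ → ts ∷* σ ≗ ts ∷* τ
∷*-cong []       e = e
∷*-cong (t ∷ ts) {σ} {τ} e = ∷*-cong ts pointwise
  where
  pointwise : t F.∷ σ ≗ t F.∷ τ
  pointwise zero    = refl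
  pointwise (suc i) = e i

-- With this, applying a multiple abstraction to the variables of its own telescope contracts to its
-- body.
bound-∷* : ∀ k → map `_ (bound k) ∷* (`_ ∘ raise k) ≗ `_ {n} {k ⊹ m}
bound-∷* zero    i = refl
bound-∷* (suc k) i = trans (∷*-cong (map `_ (bound k)) pointwise i) (bound-∷* k i)
  where
  pointwise : (` raise k zero) F.∷ (`_ ∘ raise (suc k)) ≗ `_ ∘ raise k
  pointwise zero    = refl
  pointwise (suc i) = refl

ren-∷* : (ρ : Fin m₁ → Fin m₂) (ρ′ : Fin m → Fin m′) (ts : Vec (Tm n m₁) k)
  {σ : Fin m → Tm n m₁} {τ : Fin m′ → Tm n m₂} → ren ρ ∘ σ ≗ τ ∘ ρ′ →
  ren ρ ∘ (ts ∷* σ) ≗ (map (ren ρ) ts ∷* τ) ∘ liftR* k ρ′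
ren-∷* ρ ρ′ []       e = e
ren-∷* ρ ρ′ (t ∷ ts) {σ} {τ} e = ren-∷* ρ (liftR ρ′) ts pointwise
  where
  pointwise : ren ρ ∘ (t F.∷ σ) ≗ (ren ρ t F.∷ τ) ∘ liftR ρ′
  pointwise zero    = refl
  pointwise (suc i) = e i

-- Typing

⊢-≡ : ∀ {Γ : Ctx n m} {t A B} → A ≡ B → Γ ⊢ t ∶ A → Γ ⊢ t ∶ B
⊢-≡ refl ⊢t = ⊢t

infix 4 _⟶[_]_
_⟶[_]_ : Ctx n m → (Fin m → Fin m′) → Ctx n m′ → Set
Γ ⟶[ ρ ] Δ = ∀ i → lookup Δ (ρ i) ≡ lookup Γ i

⟶-liftR : ∀ {Γ : Ctx n m} {Δ : Ctx n m′} {ρ} {C} →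
  Γ ⟶[ ρ ] Δ → C ∷ Γ ⟶[ liftR ρ ] C ∷ Δ
⟶-liftR r zero    = refl
⟶-liftR r (suc i) = r i

⟶-liftR* : ∀ {Γ : Ctx n m} {Δ : Ctx n m′} {ρ} (Cs : Vec (Ty n) k) →
  Γ ⟶[ ρ ] Δ → Γ ▸* Cs ⟶[ liftR* k ρ ] Δ ▸* Cs
⟶-liftR* []       r = r
⟶-liftR* (C ∷ Cs) r = ⟶-liftR* Cs (⟶-liftR r)

⟶-↑1 : ∀ (Γ : Ctx n m) (Δ : Ctx n m′) ρ → Γ ⟶[ ρ ] Δ → Γ ↑ 1 ⟶[ ρ ] Δ ↑ 1
⟶-↑1 Γ Δ ρ r i =
  trans (lookup-map (ρ i) _ Δ) (trans (cong (renT suc) (r i)) (sym (lookup-map i _ Γ)))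

⟶-raise : ∀ {Γ : Ctx n m} (Cs : Vec (Ty n) k) → Γ ⟶[ raise k ] Γ ▸* Cs
⟶-raise []       i = refl
⟶-raise (C ∷ Cs) i = ⟶-raise Cs (suc i)

⊢ren : ∀ {Γ : Ctx n m} {Δ : Ctx n m′} {ρ t A} →
  Γ ⟶[ ρ ] Δ → Γ ⊢ t ∶ A → Δ ⊢ ren ρ t ∶ A
⊢ren r (var i)    = ⊢-≡ (r i) (var _)
⊢ren r (lam ⊢t)   = lam (⊢ren (⟶-liftR r) ⊢t)
⊢ren r (app ⊢t ⊢u) = app (⊢ren r ⊢t) (⊢ren r ⊢u)
⊢ren {Γ = Γ} {Δ} {ρ} r (Lam ⊢t) = Lam (⊢ren (⟶-↑1 Γ Δ ρ r) ⊢t)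
⊢ren r (App ⊢t C) = App (⊢ren r ⊢t) C

↑1-renT : (ξ : Fin n → Fin n′) (Γ : Ctx n m) → map (renT (liftR ξ)) (Γ ↑ 1) ≡ map (renT ξ) Γ ↑ 1
↑1-renT ξ Γ =
  trans (sym (map-∘ _ _ Γ)) (trans (map-cong (renT-liftR-suc ξ) Γ) (map-∘ _ _ Γ))

⊢renᵗ : ∀ {Γ : Ctx n m} {t A} (ξ : Fin n → Fin n′) →
  Γ ⊢ t ∶ A → map (renT ξ) Γ ⊢ renᵗ ξ t ∶ renT ξ A
⊢renᵗ {Γ = Γ} ξ (var i) = ⊢-≡ (lookup-map i (renT ξ) Γ) (var i)
⊢renᵗ ξ (lam ⊢t)    = lam (⊢renᵗ ξ ⊢t)
⊢renᵗ ξ (app ⊢t ⊢u) = app (⊢renᵗ ξ ⊢t) (⊢renᵗ ξ ⊢u)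
⊢renᵗ {Γ = Γ} ξ (Lam ⊢t) = Lam (subst (_⊢ _ ∶ _) (↑1-renT ξ Γ) (⊢renᵗ (liftR ξ) ⊢t))
⊢renᵗ ξ (App {A = A} ⊢t C) =
  ⊢-≡ (sym (renT-[]ᵀ ξ A C)) (App (⊢renᵗ ξ ⊢t) (renT ξ C))

infix 4 _⊢ˢ_∶_
_⊢ˢ_∶_ : Ctx n m′ → (Fin m → Tm n m′) → Ctx n m → Set
Δ ⊢ˢ σ ∶ Γ = ∀ i → Δ ⊢ σ i ∶ lookup Γ i

⊢ˢ-∷ : ∀ {Γ : Ctx n m} {Δ : Ctx n m′} {σ t C} →
  Δ ⊢ t ∶ C → Δ ⊢ˢ σ ∶ Γ → Δ ⊢ˢ t F.∷ σ ∶ C ∷ Γ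
⊢ˢ-∷ ⊢t ⊢σ zero    = ⊢t
⊢ˢ-∷ ⊢t ⊢σ (suc i) = ⊢σ i

⊢ˢ-liftS : ∀ {Γ : Ctx n m} {Δ : Ctx n m′} {σ C} →
  Δ ⊢ˢ σ ∶ Γ → C ∷ Δ ⊢ˢ liftS σ ∶ C ∷ Γ
⊢ˢ-liftS ⊢σ = ⊢ˢ-∷ (var zero) (⊢ren (λ _ → refl) ∘ ⊢σ)

⊢sub : ∀ {Γ : Ctx n m} {Δ : Ctx n m′} {σ t A} →
  Δ ⊢ˢ σ ∶ Γ → Γ ⊢ t ∶ A → Δ ⊢ sub σ t ∶ A
⊢sub ⊢σ (var i)     = ⊢σ i
⊢sub ⊢σ (lam ⊢t)    = lam (⊢sub (⊢ˢ-liftS ⊢σ) ⊢t)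
⊢sub ⊢σ (app ⊢t ⊢u) = app (⊢sub ⊢σ ⊢t) (⊢sub ⊢σ ⊢u)
⊢sub {Γ = Γ} ⊢σ (Lam ⊢t) =
  Lam (⊢sub (λ i → ⊢-≡ (sym (lookup-map i (renT suc) Γ)) (⊢renᵗ suc (⊢σ i))) ⊢t)
⊢sub ⊢σ (App ⊢t C)  = App (⊢sub ⊢σ ⊢t) C

⊢ƛ* : ∀ {Γ : Ctx n m} (Cs : Vec (Ty n) k) {u D} → Γ ▸* Cs ⊢ u ∶ D → Γ ⊢ ƛ* Cs u ∶ Cs ⇒* D
⊢ƛ* []       ⊢u = ⊢u
⊢ƛ* (C ∷ Cs) ⊢u = lam (⊢ƛ* Cs ⊢u)

⊢·* : ∀ {Γ : Ctx n m} {Cs : Vec (Ty n) k} {t D} {us : Vec (Tm n m) k} →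
  Γ ⊢ t ∶ Cs ⇒* D → Pointwise (Γ ⊢_∶_) us Cs → Γ ⊢ t ·* us ∶ D
⊢·* ⊢t []         = ⊢t
⊢·* ⊢t (⊢u ∷ ⊢us) = ⊢·* (app ⊢t ⊢u) ⊢us

⊢bound : ∀ {Γ : Ctx n m} (Cs : Vec (Ty n) k) →
  Pointwise (Γ ▸* Cs ⊢_∶_) (map `_ (bound k)) Cs
⊢bound []       = []
⊢bound (C ∷ Cs) = ⊢-≡ (⟶-raise Cs zero) (var (raise (length Cs) zero)) ∷ ⊢bound Cs

-- Typing of the functorial action

⊢renᵗ-• : ∀ {Γ : Ctx n m} {t A} → Γ ⊢ t ∶ `∀ A → Γ ↑ 1 ⊢ renᵗ suc t • var zero ∶ A
⊢renᵗ-• {A = A} ⊢t =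
  ⊢-≡ (renT-liftR-suc-[]ᵀ A) (App (⊢renᵗ suc ⊢t) (var zero))

-- The invariant behind the two substitutions carried by `Φ`: at a variable other than `X` the term
-- is returned unchanged, so its source and target types must coincide there.
AgreeOff : Fin n → (σ τ : Fin n → Ty n′) → Set
AgreeOff X σ τ = ∀ Y → X ≢ Y → σ Y ≡ τ Y

AgreeOff-liftT : ∀ {X : Fin n} {σ τ : Fin n → Ty n′} →
  AgreeOff X σ τ → AgreeOff (suc X) (liftT σ) (liftT τ)
AgreeOff-liftT a zero    ne = refl
AgreeOff-liftT a (suc Y) ne = cong (renT suc) (a Y (ne ∘ cong suc))

mutual
  -- The domain of an arrow exchanges `σ` and `τ` and flips the polarity, while `v` keeps its
  -- direction. The two polarities are therefore typed by one simultaneous induction.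
  ⊢Φ⁺ : ∀ {X : Fin n} {σ τ : Fin n → Ty n′} A {Γ : Ctx n′ m} {v t} →
    OnlyPositive X A → AgreeOff X σ τ → σ X ∷ Γ ⊢ v ∶ τ X →
    Γ ⊢ t ∶ subT σ A → Γ ⊢ Φ X σ τ A v t ∶ subT τ A
  ⊢Φ⁺ {X = X} (var Y) pos a ⊢v ⊢t with X ≟ Y
  ... | yes refl = ⊢sub (⊢ˢ-∷ ⊢t var) ⊢v
  ... | no  ne   = ⊢-≡ (a Y ne) ⊢t
  ⊢Φ⁺ (C ⇒ D) pos a ⊢v ⊢t =
    lam (⊢Φ⁺ D (pos ∘ right) a ⊢v′
      (app (⊢ren (λ _ → refl) ⊢t)
        (⊢Φ⁻ C (pos ∘ left) (λ Y ne → sym (a Y ne)) ⊢v′ (var zero))))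
    where ⊢v′ = ⊢ren (⟶-liftR (λ _ → refl)) ⊢v
  ⊢Φ⁺ (`∀ C) pos a ⊢v ⊢t =
    Lam (⊢Φ⁺ C (pos ∘ under) (AgreeOff-liftT a) (⊢renᵗ suc ⊢v) (⊢renᵗ-• ⊢t))

  ⊢Φ⁻ : ∀ {X : Fin n} {σ τ : Fin n → Ty n′} A {Γ : Ctx n′ m} {v t} →
    OnlyNegative X A → AgreeOff X σ τ → τ X ∷ Γ ⊢ v ∶ σ X →
    Γ ⊢ t ∶ subT σ A → Γ ⊢ Φ X σ τ A v t ∶ subT τ A
  ⊢Φ⁻ {X = X} (var Y) neg a ⊢v ⊢t with X ≟ Y
  -- `X` occurs positively in itself, which the polarity hypothesis excludes.
  ... | yes refl = ⊥-elim (neg here)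
  ... | no  ne   = ⊢-≡ (a Y ne) ⊢t
  ⊢Φ⁻ (C ⇒ D) neg a ⊢v ⊢t =
    lam (⊢Φ⁻ D (neg ∘ right) a ⊢v′
      (app (⊢ren (λ _ → refl) ⊢t)
        (⊢Φ⁺ C (neg ∘ left) (λ Y ne → sym (a Y ne)) ⊢v′ (var zero))))
    where ⊢v′ = ⊢ren (⟶-liftR (λ _ → refl)) ⊢v
  ⊢Φ⁻ (`∀ C) neg a ⊢v ⊢t =
    Lam (⊢Φ⁻ C (neg ∘ under) (AgreeOff-liftT a) (⊢renᵗ suc ⊢v) (⊢renᵗ-• ⊢t))

-- Equational theory

≃-≡ˡ : ∀ {Γ : Ctx n m} {t t′ u A} → t ≡ t′ → Γ ⊢ t ≃[ 𝒯 ] u ∶ A → Γ ⊢ t′ ≃[ 𝒯 ] u ∶ A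
≃-≡ˡ refl e = e

≃-≡ʳ : ∀ {Γ : Ctx n m} {t u u′ A} → u ≡ u′ → Γ ⊢ t ≃[ 𝒯 ] u ∶ A → Γ ⊢ t ≃[ 𝒯 ] u′ ∶ A
≃-≡ʳ refl e = e

-- The theory ε is left out because renaming an ε-rule would require commuting
-- the renaming with its clauses; the equations to be weakened never use it.
≃-ren : ∀ {Γ : Ctx n m} {Δ : Ctx n m′} {ρ t u A} → 𝒯 ≢ ε →
  Γ ⟶[ ρ ] Δ → Γ ⊢ t ≃[ 𝒯 ] u ∶ A → Δ ⊢ ren ρ t ≃[ ε ] ren ρ u ∶ A
≃-ren ne r (≃-refl ⊢t)     = ≃-refl (⊢ren r ⊢t)
≃-ren ne r (≃-sym e)       = ≃-sym (≃-ren ne r e)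
≃-ren ne r (≃-trans e e′)  = ≃-trans (≃-ren ne r e) (≃-ren ne r e′)
≃-ren ne r (ƛ-cong e)      = ƛ-cong (≃-ren ne (⟶-liftR r) e)
≃-ren ne r (·-cong e e′)   = ·-cong (≃-ren ne r e) (≃-ren ne r e′)
≃-ren {Γ = Γ} {Δ} {ρ} ne r (Λ-cong e) = Λ-cong (≃-ren ne (⟶-↑1 Γ Δ ρ r) e)
≃-ren ne r (•-cong e C)    = •-cong (≃-ren ne r e) C
≃-ren {ρ = ρ} ne r (⇒-η {A = A} {t = t} ⊢t) =
  ≃-≡ˡ (cong (λ s → ƛ A (s · ` zero)) (ren-square (λ _ → refl) t)) (⇒-η (⊢ren r ⊢t))
≃-ren {ρ = ρ} ne r (∀-η {t = t} ⊢t) =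
  ≃-≡ˡ (cong (λ s → Λ (s • var zero)) (sym (ren-renᵗ ρ suc t))) (∀-η (⊢ren r ⊢t))
≃-ren {ρ = ρ} ne r (⇒-β {t = t} {u = u} _ ⊢t ⊢u) =
  ≃-≡ʳ (sym (ren-[] ρ t u)) (⇒-β ε (⊢ren (⟶-liftR r) ⊢t) (⊢ren r ⊢u))
≃-ren {Γ = Γ} {Δ} {ρ} ne r (∀-β {t = t} _ ⊢t C) =
  ≃-≡ʳ (sym (ren-subᵗ ρ [ C /0] t))
    (∀-β ε (⊢ren (⟶-↑1 Γ Δ ρ r) ⊢t) C)
≃-ren ne r (ε⁺ _ _ _ _ _ _ _ _ _ _ _) = ⊥-elim (ne refl)
≃-ren ne r (ε⁻ _ _ _ _ _ _ _ _ _ _)   = ⊥-elim (ne refl)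

·*-cong : ∀ {Γ : Ctx n m} {Cs : Vec (Ty n) k} {t t′ D} {us : Vec (Tm n m) k} →
  Γ ⊢ t ≃[ 𝒯 ] t′ ∶ Cs ⇒* D → Pointwise (Γ ⊢_∶_) us Cs →
  Γ ⊢ t ·* us ≃[ 𝒯 ] t′ ·* us ∶ D
·*-cong e []         = e
·*-cong e (⊢u ∷ ⊢us) = ·*-cong (·-cong e (≃-refl ⊢u)) ⊢us

-- The abstraction appears under a substitution `σ` because contracting its first redex leaves the
-- remaining abstractions substituted; the induction needs a form closed under this step.
⇒*-β : ∀ {Γ : Ctx n m} {Δ : Ctx n m′} {Cs : Vec (Ty n) k} {σ u D}
  {ts : Vec (Tm n m′) k} → Hasβ 𝒯 →
  Δ ⊢ˢ σ ∶ Γ → Γ ▸* Cs ⊢ u ∶ D → Pointwise (Δ ⊢_∶_) ts Cs →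
  Δ ⊢ sub σ (ƛ* Cs u) ·* ts ≃[ 𝒯 ] sub (ts ∷* σ) u ∶ D
⇒*-β b ⊢σ ⊢u [] = ≃-refl (⊢sub ⊢σ ⊢u)
⇒*-β {Cs = C ∷ Cs} {σ} {u} {ts = t ∷ ts} b ⊢σ ⊢u (⊢t ∷ ⊢ts) =
  ≃-trans
    (·*-cong
      (≃-≡ʳ (liftS-[] σ (ƛ* Cs u) t)
        (⇒-β b (⊢sub (⊢ˢ-liftS ⊢σ) (⊢ƛ* Cs ⊢u)) ⊢t))
      ⊢ts)
    (⇒*-β b (⊢ˢ-∷ ⊢t ⊢σ) ⊢u ⊢ts)

-- Two telescopes are kept apart: the abstraction may expect `Q k [ D /X]` while its arguments are
-- built from variables of types `Q k [ C /X]`.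
⇒*-β-raise : ∀ {Γ : Ctx n m} {Cs Es : Vec (Ty n) k} {u D} {ts : Vec (Tm n (k ⊹ m)) k} →
  Γ ▸* Cs ⊢ u ∶ D → Pointwise (Γ ▸* Es ⊢_∶_) ts Cs →
  Γ ▸* Es ⊢ ren (raise k) (ƛ* Cs u) ·* ts ≃[ ε ] sub (ts ∷* (`_ ∘ raise k)) u ∶ D
⇒*-β-raise {k = k} {Cs = Cs} {Es} {u} {ts = ts} ⊢u ⊢ts =
  ≃-≡ˡ (cong (_·* ts) (sub-renaming (raise k) (λ _ → refl) (ƛ* Cs u)))
    (⇒*-β ε (λ i → ⊢-≡ (⟶-raise Es i) (var (raise k i))) ⊢u ⊢ts)

-- Going through the redex ƛ C w · t avoids a substitution lemma for ≃.
[]-cong : ∀ {Γ : Ctx n m} {C D w w′ t t′} → Hasβ 𝒯 →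
  C ∷ Γ ⊢ w ∶ D → C ∷ Γ ⊢ w′ ∶ D → Γ ⊢ t ∶ C → Γ ⊢ t′ ∶ C →
  C ∷ Γ ⊢ w ≃[ 𝒯 ] w′ ∶ D → Γ ⊢ t ≃[ 𝒯 ] t′ ∶ C → Γ ⊢ w [ t ] ≃[ 𝒯 ] w′ [ t′ ] ∶ D
[]-cong b ⊢w ⊢w′ ⊢t ⊢t′ e e′ =
  ≃-trans (≃-sym (⇒-β b ⊢w ⊢t)) (≃-trans (·-cong (ƛ-cong e) e′) (⇒-β b ⊢w′ ⊢t′))

-- Algebras, iteration and fusion

map-id′ : ∀ {a} {A : Set a} {f : A → A} → f ≗ id → (xs : Vec A k) → map f xs ≡ xs
map-id′ e xs = trans (map-cong e xs) (map-id xs)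

Φ* : (C D : Ty n) (w : Tm n (suc m)) → Vec (Ty (suc n)) k → Vec (Tm n m) k → Vec (Tm n m) k
Φ* C D w = zipWith (λ A x → Φ zero [ C /0] [ D /0] A w x)

⊢Φ* : ∀ {Γ : Ctx n m} {C D w} {As : Vec (Ty (suc n)) k} {ts} →
  C ∷ Γ ⊢ w ∶ D → All (OnlyPositive zero) As →
  Pointwise (Γ ⊢_∶_) ts (map (_[ C ]ᵀ) As) →
  Pointwise (Γ ⊢_∶_) (Φ* C D w As ts) (map (_[ D ]ᵀ) As)
⊢Φ* {As = []}     ⊢w []       []         = []
⊢Φ* {C = C} {D} {As = A ∷ As} ⊢w (p ∷ ps) (⊢t ∷ ⊢ts) =
  ⊢Φ⁺ A p agree ⊢w ⊢t ∷ ⊢Φ* ⊢w ps ⊢ts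
  where
  agree : AgreeOff zero [ C /0] [ D /0]
  agree zero    ne = ⊥-elim (ne refl)
  agree (suc Y) ne = refl

ren-Φ* : ∀ (ρ : Fin m → Fin m′) (C D : Ty n) w (As : Vec (Ty (suc n)) k) ts →
  map (ren ρ) (Φ* C D w As ts) ≡ Φ* C D (ren (liftR ρ) w) As (map (ren ρ) ts)
ren-Φ* ρ C D w []       []       = refl
ren-Φ* ρ C D w (A ∷ As) (t ∷ ts) =
  cong₂ _∷_ (ren-Φ ρ zero [ C /0] [ D /0] A w t) (ren-Φ* ρ C D w As ts)

ren-Algebra : ∀ {P : Poly n} (Γ : Ctx n m) (Δ : Ctx n m′) {C} (ρ : Fin m → Fin m′) →
  Γ ⟶[ ρ ] Δ → Algebra P Γ C → Algebra P Δ C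
ren-Algebra {P = P} Γ Δ ρ r 𝒜 = record
  { op    = λ k → ren (liftR* (J k) ρ) (Algebra.op 𝒜 k)
  ; typed = λ k → ⊢ren (⟶-liftR* (Q k [ _ /X]) r) (Algebra.typed 𝒜 k)
  }
  where open Poly P

map-▸* : ∀ (f : Ty n → Ty n′) (Γ : Ctx n m) (Cs : Vec (Ty n) k) →
  map f (Γ ▸* Cs) ≡ map f Γ ▸* map f Cs
map-▸* f Γ []       = refl
map-▸* f Γ (C ∷ Cs) = map-▸* f (C ∷ Γ) Cs

map-renT-[]ᵀ : ∀ (ξ : Fin n → Fin n′) (C : Ty n) (As : Vec (Ty (suc n)) k) →
  map (renT ξ) (map (_[ C ]ᵀ) As) ≡ map (_[ renT ξ C ]ᵀ) (map (renT (liftR ξ)) As)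
map-renT-[]ᵀ ξ C As =
  trans (sym (map-∘ _ _ As)) (trans (map-cong (λ A → renT-[]ᵀ ξ A C) As) (map-∘ _ _ As))

renᵗ-Algebra : ∀ {P : Poly n} {Γ : Ctx n m} {C} (ξ : Fin n → Fin n′) →
  Algebra P Γ C → Algebra (renP ξ P) (map (renT ξ) Γ) (renT ξ C)
renᵗ-Algebra {P = P} {Γ} {C} ξ 𝒜 = record
  { op    = λ k → renᵗ ξ (Algebra.op 𝒜 k)
  ; typed = λ k →
      subst (_⊢ renᵗ ξ (Algebra.op 𝒜 k) ∶ renT ξ C)
        (trans (map-▸* (renT ξ) Γ (Q k [ C /X]))
          (cong (map (renT ξ) Γ ▸*_) (map-renT-[]ᵀ ξ C (Q k))))
        (⊢renᵗ ξ (Algebra.typed 𝒜 k))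
  }
  where open Poly P

-- The equations of a morphism after its inclusion has been absorbed into the source algebra, so
-- that both algebras share a context. The theory is a parameter since a morphism provides `βη` and
-- fusion consumes `ε`.
Commutes : Theory → (P : Poly n) {Γ : Ctx n m} {C D : Ty n} →
  Algebra P Γ C → Algebra P Γ D → Tm n (suc m) → Set
Commutes 𝒯 P {Γ} {C} {D} 𝒜 ℬ w = ∀ k →
  let w′ = ren (liftR (raise (J k))) w in
  Γ ▸* Q k [ C /X]
    ⊢ w′ [ Algebra.op 𝒜 k ]
    ≃[ 𝒯 ] sub (Φ* C D w′ (Q k) (map `_ (bound (J k))) ∷* (`_ ∘ raise (J k))) (Algebra.op ℬ k)
    ∶ D
  where open Poly P

-- Renaming commutes with substitution and with `Φ`, and a renaming lifted over a telescope fixes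
-- the variables of that telescope; hence each side is carried to the corresponding side for the
-- renamed algebras.
Commutes-ren : ∀ (P : Poly n) (Γ : Ctx n m) (Δ : Ctx n m′) {C D} {ρ}
  (r : Γ ⟶[ ρ ] Δ) (𝒜 : Algebra P Γ C) (ℬ : Algebra P Γ D) {w} → 𝒯 ≢ ε →
  Commutes 𝒯 P 𝒜 ℬ w →
  Commutes ε P (ren-Algebra Γ Δ ρ r 𝒜) (ren-Algebra Γ Δ ρ r ℬ) (ren (liftR ρ) w)
Commutes-ren P Γ Δ {C} {D} {ρ} r 𝒜 ℬ {w} ne commutes k =
  ≃-≡ˡ (trans (ren-[] ρ* w′ (Algebra.op 𝒜 k)) (cong (_[ ren ρ* (Algebra.op 𝒜 k) ]) w-eq))
    (≃-≡ʳ rhs (≃-ren ne (⟶-liftR* (Q k [ C /X]) r) (commutes k)))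
  where
  open Poly P
  ρ* = liftR* (J k) ρ
  w′ = ren (liftR (raise (J k))) w
  z⃗ : ∀ {m} → Vec (Tm _ (J k ⊹ m)) (J k)
  z⃗ = map `_ (bound (J k))

  w-eq : ren (liftR ρ*) w′ ≡ ren (liftR (raise (J k))) (ren (liftR ρ) w)
  w-eq = ren-square (liftR-square (liftR*-raise (J k) ρ)) w

  z⃗-eq : map (ren ρ*) z⃗ ≡ z⃗
  z⃗-eq =
    trans (sym (map-∘ (ren ρ*) `_ (bound (J k))))
      (trans (map-∘ `_ ρ* (bound (J k))) (cong (map `_) (map-liftR*-bound (J k) ρ)))

  Φ-eq : map (ren ρ*) (Φ* C D w′ (Q k) z⃗) ≡
         Φ* C D (ren (liftR (raise (J k))) (ren (liftR ρ) w)) (Q k) z⃗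
  Φ-eq = trans (ren-Φ* ρ* C D w′ (Q k) z⃗) (cong₂ (λ w → Φ* C D w (Q k)) w-eq z⃗-eq)

  rhs : ren ρ* (sub (Φ* C D w′ (Q k) z⃗ ∷* (`_ ∘ raise (J k))) (Algebra.op ℬ k)) ≡
        sub (Φ* C D (ren (liftR (raise (J k))) (ren (liftR ρ) w)) (Q k) z⃗
               ∷* (`_ ∘ raise (J k)))
          (ren ρ* (Algebra.op ℬ k))
  rhs =
    trans (ren-sub ρ* _ (Algebra.op ℬ k))
      (trans (sub-cong pointwise (Algebra.op ℬ k))
        (trans (sym (sub-ren _ ρ* (Algebra.op ℬ k)))
          (cong (λ ts → sub (ts ∷* (`_ ∘ raise (J k))) (ren ρ* (Algebra.op ℬ k))) Φ-eq)))
    where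
    pointwise : ren ρ* ∘ (Φ* C D w′ (Q k) z⃗ ∷* (`_ ∘ raise (J k))) ≗
                (map (ren ρ*) (Φ* C D w′ (Q k) z⃗) ∷* (`_ ∘ raise (J k))) ∘ ρ*
    pointwise = ren-∷* ρ* ρ (Φ* C D w′ (Q k) z⃗) (cong `_ ∘ liftR*-raise (J k) ρ)

-- `Ind` filled with `t`, as a plain term, so that the laws for renaming terms apply to it.
fold : (P : Poly n) (C : Ty n) → (∀ k → Tm n (Poly.J P k ⊹ m)) → Tm n m → Tm n m
fold P C u t = t • C ·* tabulate (λ k → ƛ* (Q k [ C /X]) (u k))
  where open Poly P

fold-cong : ∀ (P : Poly n) (C : Ty n) {u u′ : ∀ k → Tm n (Poly.J P k ⊹ m)} t →
  (∀ k → u k ≡ u′ k) → fold P C u t ≡ fold P C u′ t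
fold-cong P C t e =
  cong (t • C ·*_) (tabulate-cong (λ k → cong (ƛ* (Q k [ C /X])) (e k)))
  where open Poly P

ren-fold : ∀ (P : Poly n) C u (ρ : Fin m → Fin m′) t →
  ren ρ (fold P C u t) ≡ fold P C (λ k → ren (liftR* (Poly.J P k) ρ) (u k)) (ren ρ t)
ren-fold P C u ρ t =
  trans (ren-·* ρ (t • C) (tabulate λ k → ƛ* (Q k [ C /X]) (u k)))
    (cong (ren ρ t • C ·*_)
      (trans (sym (tabulate-∘ (ren ρ) _)) (tabulate-cong (λ k → ren-ƛ* ρ (Q k [ C /X]) (u k)))))
  where open Poly P

renᵗ-fold : ∀ (P : Poly n) C u (ξ : Fin n → Fin n′) (t : Tm n m) →
  renᵗ ξ (fold P C u t) ≡ fold (renP ξ P) (renT ξ C) (λ k → renᵗ ξ (u k)) (renᵗ ξ t)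
renᵗ-fold P C u ξ t =
  trans (renᵗ-·* ξ (t • C) (tabulate λ k → ƛ* (Q k [ C /X]) (u k)))
    (cong (renᵗ ξ t • renT ξ C ·*_)
      (trans (sym (tabulate-∘ (renᵗ ξ) _))
        (tabulate-cong λ k →
          trans (renᵗ-ƛ* ξ (Q k [ C /X]) (u k))
            (cong (λ Cs → ƛ* Cs (renᵗ ξ (u k))) (map-renT-[]ᵀ ξ C (Q k))))))
  where open Poly P

⊢fold : ∀ (P : Poly n) {Γ : Ctx n m} {C} (𝒜 : Algebra P Γ C) {t} →
  Γ ⊢ t ∶ `∀ (Poly.type P) → Γ ⊢ fold P C (Algebra.op 𝒜) t ∶ C
⊢fold P {C = C} 𝒜 ⊢t =
  ⊢·* (⊢-≡ type-[]ᵀ (App ⊢t C)) (PW.tabulate⁺ (λ k → ⊢ƛ* (Q k [ C /X]) (Algebra.typed 𝒜 k)))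
  where
  open Poly P
  type-[]ᵀ : type [ C ]ᵀ ≡ tabulate (λ k → Q k [ C /X] ⇒* C) ⇒* C
  type-[]ᵀ =
    trans (subT-⇒* [ C /0] _ (var zero))
      (cong (_⇒* C)
        (trans (sym (tabulate-∘ (_[ C ]ᵀ) _))
          (tabulate-cong (λ k → subT-⇒* [ C /0] (Q k) (var zero)))))

renT-type : ∀ (ξ : Fin n → Fin n′) (P : Poly n) →
  renT (liftR ξ) (Poly.type P) ≡ Poly.type (renP ξ P)
renT-type ξ P =
  trans (renT-⇒* (liftR ξ) _ (var zero))
    (cong (_⇒* var zero)
      (trans (sym (tabulate-∘ (renT (liftR ξ)) _))
        (tabulate-cong (λ k → renT-⇒* (liftR ξ) (Poly.Q P k) (var zero)))))

-- `Φ` at the type variable `X` computes to substitution into `w`, so the conclusion of `ε⁺` is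
-- already this equation and only its clauses remain to be shown.
fold-fusion : ∀ (P : Poly n) {Γ : Ctx n m} {C D} (𝒜 : Algebra P Γ C) (ℬ : Algebra P Γ D) {w t} →
  C ∷ Γ ⊢ w ∶ D → Commutes ε P 𝒜 ℬ w → Γ ⊢ t ∶ `∀ (Poly.type P) →
  Γ ⊢ w [ fold P C (Algebra.op 𝒜) t ] ≃[ ε ] fold P D (Algebra.op ℬ) t ∶ D
fold-fusion {n} {m} P {Γ} {C} {D} 𝒜 ℬ {w} ⊢w commutes ⊢t =
  -- The clauses of a polynomial type quantify over no type variables, hence the constant 0; `λ ()`
  -- refutes a negative occurrence of `X` in `X`.
  ε⁺ (λ _ → 0) J Q (var zero) positive (λ ()) ⊢t
    (λ k → ⊢-≡ (cong (Q k [ C /X] ⇒*_) (sym (renT-id (λ _ → refl) C))) (⊢e k))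
    (λ k → ⊢-≡ (cong (Q k [ D /X] ⇒*_) (sym (renT-id (λ _ → refl) D))) (⊢f k))
    ⊢w clause
  where
  open Poly P
  module 𝒜 = Algebra 𝒜
  module ℬ = Algebra ℬ

  e f : ∀ k → Tm n m
  e k = ƛ* (Q k [ C /X]) (𝒜.op k)
  f k = ƛ* (Q k [ D /X]) (ℬ.op k)

  ⊢e : ∀ k → Γ ⊢ e k ∶ Q k [ C /X] ⇒* C
  ⊢e k = ⊢ƛ* (Q k [ C /X]) (𝒜.typed k)

  ⊢f : ∀ k → Γ ⊢ f k ∶ Q k [ D /X] ⇒* D
  ⊢f k = ⊢ƛ* (Q k [ D /X]) (ℬ.typed k)

  -- ε⁺ renames along raise (y k), which for y k = 0 is the identity only
  -- propositionally once it acts on types, terms and contexts.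
  Clause : ∀ k → Ctx n m → Tm n (suc m) → (e f : Tm n m) → Ty n → Set
  Clause k Γ w e f E =
    Γ ▸* Q k [ C /X]
      ⊢ w′ [ ren (raise (J k)) e ·* z⃗ ] ≃[ ε ] ren (raise (J k)) f ·* Φ* C D w′ (Q k) z⃗ ∶ E
    where
    w′ = ren (liftR (raise (J k))) w
    z⃗  = map `_ (bound (J k))

  clause : ∀ k → Clause k (Γ ↑ 0) (renᵗ id w) (renᵗ id (e k)) (renᵗ id (f k)) (renT id D)
  clause k
    rewrite map-id′ (renT-id (λ _ → refl)) Γ
          | renT-id {ρ = id} (λ _ → refl) D
          | renᵗ-id {ξ = id} (λ _ → refl) w
          | renᵗ-id {ξ = id} (λ _ → refl) (e k)
          | renᵗ-id {ξ = id} (λ _ → refl) (f k) =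
    ≃-trans
      ([]-cong ε ⊢w′ ⊢w′ (⊢·* (⊢ren (⟶-raise Cs) (⊢e k)) (⊢bound Cs)) (𝒜.typed k) (≃-refl ⊢w′)
        (≃-≡ʳ (sub-id (bound-∷* (J k)) (𝒜.op k))
          (⇒*-β-raise {Es = Cs} (𝒜.typed k) (⊢bound Cs))))
      (≃-trans (commutes k)
        -- Positivity of `Q k` makes the arguments `Φ` of the telescope variables well typed, as β
        -- requires.
        (≃-sym (⇒*-β-raise {Es = Cs} (ℬ.typed k) (⊢Φ* ⊢w′ (positive k) (⊢bound Cs)))))
    where
    Cs = Q k [ C /X]
    ⊢w′ : C ∷ (Γ ▸* Cs) ⊢ ren (liftR (raise (J k))) w ∶ D
    ⊢w′ = ⊢ren (⟶-liftR (⟶-raise Cs)) ⊢w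

-- Introduction and elimination contexts

liftSᴵ : (In : Intro n n′) → (Fin m → Tm n m′) → Fin (In ⊹ᴵ m) → Tm n′ (In ⊹ᴵ m′)
liftSᴵ □        σ = σ
liftSᴵ (Λ In)   σ = liftSᴵ In (renᵗ suc ∘ σ)
liftSᴵ (ƛ C In) σ = liftSᴵ In (liftS σ)

sub-fillᴵ : (In : Intro n n′) (σ : Fin m → Tm n m′) (t : Tm n′ (In ⊹ᴵ m)) →
  sub σ (fillᴵ In t) ≡ fillᴵ In (sub (liftSᴵ In σ) t)
sub-fillᴵ □        σ t = refl
sub-fillᴵ (Λ In)   σ t = cong Λ (sub-fillᴵ In (renᵗ suc ∘ σ) t)
sub-fillᴵ (ƛ C In) σ t = cong (ƛ C) (sub-fillᴵ In (liftS σ) t)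

-- A variable from outside `In` receives a value weakened past all binders crossed. Type and term
-- weakenings commute, so they can be collected separately although the binders are interleaved.
liftSᴵ-raiseᴵ : (In : Intro n n′) (σ : Fin m → Tm n m′) (i : Fin m) →
  liftSᴵ In σ (raiseᴵ In i) ≡ ren (raiseᴵ In) (renᵗ (raiseᵗ In) (σ i))
liftSᴵ-raiseᴵ □ σ i =
  sym (trans (ren-id (λ _ → refl) _) (renᵗ-id (λ _ → refl) (σ i)))
liftSᴵ-raiseᴵ (Λ In) σ i =
  trans (liftSᴵ-raiseᴵ In (renᵗ suc ∘ σ) i)
    (cong (ren (raiseᴵ In)) (renᵗ-∘ (raiseᵗ In) suc (σ i)))
liftSᴵ-raiseᴵ (ƛ C In) σ i =
  trans (liftSᴵ-raiseᴵ In (liftS σ) (suc i))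
    (trans (cong (ren (raiseᴵ In)) (sym (ren-renᵗ suc (raiseᵗ In) (σ i))))
      (ren-∘ (raiseᴵ In) suc _))

-- Applied with `ρ` equal to `suc`: a variable of `El`, weakened past the hole variable, is
-- unaffected by the value substituted for that variable.
liftSᴵ-liftᴵ : (In : Intro n n′) {σ : Fin m₁ → Tm n m₂} {ρ : Fin m → Fin m₁} {ρ′ : Fin m → Fin m₂} →
  σ ∘ ρ ≗ `_ ∘ ρ′ → liftSᴵ In σ ∘ liftᴵ In ρ ≗ `_ ∘ liftᴵ In ρ′
liftSᴵ-liftᴵ □        e = e
liftSᴵ-liftᴵ (Λ In)   e = liftSᴵ-liftᴵ In (cong (renᵗ suc) ∘ e)
liftSᴵ-liftᴵ (ƛ C In) {σ} {ρ} {ρ′} e = liftSᴵ-liftᴵ In pointwise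
  where
  pointwise : liftS σ ∘ liftR ρ ≗ `_ ∘ liftR ρ′
  pointwise zero    = refl
  pointwise (suc i) = cong (ren suc) (e i)

liftᴵ-raiseᴵ : (In : Intro n n′) (ρ : Fin m → Fin m′) →
  liftᴵ In ρ ∘ raiseᴵ In ≗ raiseᴵ In ∘ ρ
liftᴵ-raiseᴵ □        ρ i = refl
liftᴵ-raiseᴵ (Λ In)   ρ i = liftᴵ-raiseᴵ In ρ i
liftᴵ-raiseᴵ (ƛ C In) ρ i = liftᴵ-raiseᴵ In (liftR ρ) (suc i)

⟶-liftᴵ : ∀ {Γ : Ctx n m} {Δ : Ctx n m′} {ρ} (In : Intro n n′) →
  Γ ⟶[ ρ ] Δ → Γ ▹ In ⟶[ liftᴵ In ρ ] Δ ▹ In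
⟶-liftᴵ □        r = r
⟶-liftᴵ {Γ = Γ} {Δ} {ρ} (Λ In) r = ⟶-liftᴵ In (⟶-↑1 Γ Δ ρ r)
⟶-liftᴵ (ƛ C In) r = ⟶-liftᴵ In (⟶-liftR r)

lookup-raiseᴵ : ∀ (In : Intro n n′) (Γ : Ctx n m) i →
  lookup (Γ ▹ In) (raiseᴵ In i) ≡ renT (raiseᵗ In) (lookup Γ i)
lookup-raiseᴵ □        Γ i = sym (renT-id (λ _ → refl) _)
lookup-raiseᴵ (Λ In)   Γ i =
  trans (lookup-raiseᴵ In (Γ ↑ 1) i)
    (trans (cong (renT (raiseᵗ In)) (lookup-map i (renT suc) Γ)) (renT-∘ (raiseᵗ In) suc _))
lookup-raiseᴵ (ƛ C In) Γ i = lookup-raiseᴵ In (C ∷ Γ) (suc i)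

⊢fillᴵ : ∀ {In : Intro n n′} {Γ : Ctx n m} {A B t} →
  In ∶ B ⊢ A → Γ ▹ In ⊢ t ∶ B → Γ ⊢ fillᴵ In t ∶ A
⊢fillᴵ □      ⊢t = ⊢t
⊢fillᴵ (Λ ⊢I) ⊢t = Lam (⊢fillᴵ ⊢I ⊢t)
⊢fillᴵ (ƛ ⊢I) ⊢t = lam (⊢fillᴵ ⊢I ⊢t)

fillᴵ-cong : ∀ {In : Intro n n′} {Γ : Ctx n m} {A B t t′} →
  In ∶ B ⊢ A → Γ ▹ In ⊢ t ≃[ 𝒯 ] t′ ∶ B → Γ ⊢ fillᴵ In t ≃[ 𝒯 ] fillᴵ In t′ ∶ A
fillᴵ-cong □      e = e
fillᴵ-cong (Λ ⊢I) e = Λ-cong (fillᴵ-cong ⊢I e)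
fillᴵ-cong (ƛ ⊢I) e = ƛ-cong (fillᴵ-cong ⊢I e)

-- Elimination contexts bind nothing, so filling one is an ordinary substitution for its hole
-- variable.
fillᴱ-renᴱ : (θ : Fin m → Fin m′) (El : Elim n m) (t : Tm n m′) →
  fillᴱ (renᴱ θ El) t ≡ sub (t F.∷ (`_ ∘ θ)) ⟦ El ⟧
fillᴱ-renᴱ θ □         t = refl
fillᴱ-renᴱ θ (El •ᴱ C) t = cong (_• C) (fillᴱ-renᴱ θ El t)
fillᴱ-renᴱ θ (El ·ᴱ u) t =
  cong₂ _·_ (fillᴱ-renᴱ θ El t)
    (sym (trans (sub-ren (t F.∷ (`_ ∘ θ)) suc u) (sub-renaming θ (λ _ → refl) u)))

fillᴱ-·*ᴱ : (θ : Fin m → Fin m′) (El : Elim n m) (us : Vec (Tm n m) k) (t : Tm n m′) →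
  fillᴱ (renᴱ θ (El ·*ᴱ us)) t ≡ fillᴱ (renᴱ θ El) t ·* map (ren θ) us
fillᴱ-·*ᴱ θ El []       t = refl
fillᴱ-·*ᴱ θ El (u ∷ us) t = fillᴱ-·*ᴱ θ (El ·ᴱ u) us t

fillᴱ-Ind : ∀ (P : Poly n) C u (θ : Fin m → Fin m′) t →
  fillᴱ (renᴱ θ (Ind P C u)) t ≡ fold P C (λ k → ren (liftR* (Poly.J P k) θ) (u k)) t
fillᴱ-Ind P C u θ t =
  trans (fillᴱ-·*ᴱ θ (□ •ᴱ C) (tabulate λ k → ƛ* (Q k [ C /X]) (u k)) t)
    (cong (t • C ·*_)
      (trans (sym (tabulate-∘ (ren θ) _)) (tabulate-cong (λ k → ren-ƛ* θ (Q k [ C /X]) (u k)))))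
  where open Poly P

-- The asymmetry of capture: `t` comes from outside and is weakened past the binders of `In`,
-- whereas `El` keeps its access to them.
sub-⟨⟩ : (In : Intro n n′) (El : Elim n′ (In ⊹ᴵ m)) (t : Tm n m′) (ρ : Fin m → Fin m′) →
  sub (t F.∷ (`_ ∘ ρ)) (In ⟨ El ⟩) ≡
  fillᴵ In (sub (ren (raiseᴵ In) (renᵗ (raiseᵗ In) t) F.∷ (`_ ∘ liftᴵ In ρ)) ⟦ El ⟧)
sub-⟨⟩ {n} {m = m} In El t ρ =
  trans (sub-fillᴵ In σ _)
    (cong (fillᴵ In)
      (trans (cong (sub (liftSᴵ In σ)) (fillᴱ-renᴱ (liftᴵ In suc) El (` raiseᴵ In zero)))
        (trans (sub-∘ (liftSᴵ In σ) _ ⟦ El ⟧) (sub-cong pointwise ⟦ El ⟧))))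
  where
  σ : Fin (suc m) → Tm n _
  σ = t F.∷ (`_ ∘ ρ)
  pointwise : sub (liftSᴵ In σ) ∘ ((` raiseᴵ In zero) F.∷ (`_ ∘ liftᴵ In suc)) ≗
              ren (raiseᴵ In) (renᵗ (raiseᵗ In) t) F.∷ (`_ ∘ liftᴵ In ρ)
  pointwise zero    = liftSᴵ-raiseᴵ In σ zero
  pointwise (suc i) = liftSᴵ-liftᴵ In (λ _ → refl) i

⊢⟨⟩ : ∀ {Δ : Ctx n m} {A B} {In : Intro n n′} {El} → Dual Δ A B In El → A ∷ Δ ⊢ In ⟨ El ⟩ ∶ A
⊢⟨⟩ {Δ = Δ} {A} {B} {In} {El} d =
  ⊢fillᴵ In-typed
    (subst (λ t → (A ∷ Δ) ▹ In ⊢ t ∶ B) (sym (fillᴱ-renᴱ (liftᴵ In suc) El (` raiseᴵ In zero)))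
      (⊢sub (⊢ˢ-∷ (⊢-≡ (lookup-raiseᴵ In (A ∷ Δ) zero) (var (raiseᴵ In zero)))
              (λ i → ⊢-≡ (⟶-liftᴵ {Γ = Δ} {A ∷ Δ} In (λ _ → refl) i) (var (liftᴵ In suc i))))
        El-typed))
  where open Dual d

-- Duality speaks of a hole variable over `Δ`. It is weakened to `Δ′`, where `t` lives, and then
-- instantiated at `t`.
dual-[] : ∀ {Δ : Ctx n m} {Δ′ : Ctx n m′} {A B} {In : Intro n n′} {El ρ t} → Dual Δ A B In El →
  Δ ⟶[ ρ ] Δ′ → Δ′ ⊢ t ∶ A →
  Δ′ ⊢ fillᴵ In (sub (ren (raiseᴵ In) (renᵗ (raiseᵗ In) t) F.∷ (`_ ∘ liftᴵ In ρ)) ⟦ El ⟧)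
     ≃[ ε ] t ∶ A
dual-[] {In = In} {El} {ρ} {t} d r ⊢t =
  ≃-≡ˡ (trans (ren-liftR-[] ρ (In ⟨ El ⟩) t) (sub-⟨⟩ In El t ρ))
    ([]-cong ε (⊢ren (⟶-liftR r) (⊢⟨⟩ d)) (var zero) ⊢t ⊢t
      (≃-ren (λ ()) (⟶-liftR r) (Dual.dual d)) (≃-refl ⊢t))

lemma8p1 : ∀ {n n′ l m : ℕ} (P : Poly n) (A : Ty n) (B : Ty n′) → B ∈RS A →
    (Γ : Ctx n l) (Δ : Ctx n m) (ρ : Fin l → Fin m) →
    (In : Intro n n′) (El : Elim n′ (In ⊹ᴵ m)) → Dual Δ A B In El →
    (𝒜 : Algebra P Γ A) (ℬ : Algebra (renP (raiseᵗ In) P) (Δ ▹ In) B) →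
    IsMorphism (raiseᵗ In) (raiseᴵ In ∘ ρ) 𝒜 ℬ ⟦ El ⟧ →
    `∀ (Poly.type P) ∷ Δ
    ⊢ ⟦ Ind P A (λ k → ren (liftR* (Poly.J P k) ρ) (Algebra.op 𝒜 k)) ⟧
    ≃[ ε ] In ⟨ Ind (renP (raiseᵗ In) P) B (Algebra.op ℬ) ⟩
    ∶ A
lemma8p1 P A B _ Γ Δ ρ In El d 𝒜 ℬ mor =
  ≃-≡ˡ (sym (fillᴱ-Ind P A _ suc (` zero)))
    (≃-trans (≃-sym (dual-[] d (λ _ → refl) (⊢fold P 𝒜↑ (var zero))))
      (fillᴵ-cong (Dual.In-typed d) fusion))
  where
  ξ  = raiseᵗ In
  P′ = renP ξ P
  θ  = liftᴵ In suc
  open Poly P using (J)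
  open IsInclusion (IsMorphism.inclusion mor)

  Δᴵ = Δ ▹ In
  Θ  = (`∀ (Poly.type P) ∷ Δ) ▹ In

  Δ⟶ : Δᴵ ⟶[ θ ] Θ
  Δ⟶ = ⟶-liftᴵ {Γ = Δ} In (λ _ → refl)

  -- The inclusion is given only into `Δ ▹ In`. Both types it equates are images under `renT ξ`,
  -- which is injective because `ξ` is.
  Γ⟶Δ : Γ ⟶[ ρ ] Δ
  Γ⟶Δ i = renT-injective ξ-injective (trans (sym (lookup-raiseᴵ In Δ (ρ i))) (preserves i))

  𝒜↑ : Algebra P (`∀ (Poly.type P) ∷ Δ) A
  𝒜↑ = ren-Algebra Δ _ suc (λ _ → refl) (ren-Algebra Γ Δ ρ Γ⟶Δ 𝒜)

  -- Its operations are renamed exactly as in `IsMorphism`, so the field `commutes` is an instance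
  -- of `Commutes βη` by computation.
  𝒜ᴵ : Algebra P′ (Δ ▹ In) (renT ξ A)
  𝒜ᴵ = ren-Algebra _ Δᴵ (raiseᴵ In ∘ ρ) (λ i → trans (preserves i) (sym (lookup-map i (renT ξ) Γ)))
         (renᵗ-Algebra ξ 𝒜)

  -- There are two routes from `Γ` to `Θ`: entering `In` before adding the variable of polynomial
  -- type, or after. They agree by `liftᴵ-raiseᴵ`.
  op-eq : ∀ k →
    Algebra.op (ren-Algebra {P = P′} Δᴵ Θ θ Δ⟶ 𝒜ᴵ) k ≡
    ren (liftR* (J k) (raiseᴵ In)) (renᵗ ξ (Algebra.op 𝒜↑ k))
  op-eq k =
    trans (ren-∘ (liftR* (J k) θ) _ (renᵗ ξ u))
      (trans (ren-cong (λ i → trans (liftR*-∘ (J k) θ (raiseᴵ In ∘ ρ) i)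
                 (liftR*-cong (J k) (λ i → liftᴵ-raiseᴵ In suc (ρ i)) i)) (renᵗ ξ u))
        (sym (trans (cong (ren (liftR* (J k) (raiseᴵ In)) ∘ renᵗ ξ) (ren-∘ _ _ u))
          (trans (cong (ren (liftR* (J k) (raiseᴵ In))) (sym (ren-renᵗ _ ξ u)))
            (trans (ren-∘ _ _ (renᵗ ξ u)) (ren-cong (λ i →
               trans (cong (liftR* (J k) (raiseᴵ In)) (liftR*-∘ (J k) suc ρ i))
                 (liftR*-∘ (J k) (raiseᴵ In) (suc ∘ ρ) i)) (renᵗ ξ u)))))))
    where u = Algebra.op 𝒜 k

  fold-eq :
    fold P′ (renT ξ A) (Algebra.op (ren-Algebra {P = P′} Δᴵ Θ θ Δ⟶ 𝒜ᴵ)) (` raiseᴵ In zero) ≡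
    ren (raiseᴵ In) (renᵗ ξ (fold P A (Algebra.op 𝒜↑) (` zero)))
  fold-eq =
    sym (trans (cong (ren (raiseᴵ In)) (renᵗ-fold P A _ ξ (` zero)))
      (trans (ren-fold P′ (renT ξ A) _ (raiseᴵ In) (` zero))
        (fold-cong P′ (renT ξ A) (` raiseᴵ In zero) (sym ∘ op-eq))))

  fusion : (`∀ (Poly.type P) ∷ Δ) ▹ In
    ⊢ sub (ren (raiseᴵ In) (renᵗ ξ (fold P A (Algebra.op 𝒜↑) (` zero))) F.∷ (`_ ∘ θ)) ⟦ El ⟧
    ≃[ ε ] fillᴱ (renᴱ θ (Ind P′ B (Algebra.op ℬ))) (` raiseᴵ In zero)
    ∶ B
  fusion =
    ≃-≡ˡ (trans (ren-liftR-[] θ ⟦ El ⟧ _) (cong (λ t → sub (t F.∷ (`_ ∘ θ)) ⟦ El ⟧) fold-eq))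
      (≃-≡ʳ (sym (fillᴱ-Ind P′ B (Algebra.op ℬ) θ (` raiseᴵ In zero)))
        (fold-fusion P′ (ren-Algebra Δᴵ Θ θ Δ⟶ 𝒜ᴵ) (ren-Algebra Δᴵ Θ θ Δ⟶ ℬ)
          (⊢ren (⟶-liftR Δ⟶) (Dual.El-typed d))
          (Commutes-ren P′ Δᴵ Θ Δ⟶ 𝒜ᴵ ℬ (λ ()) (IsMorphism.commutes mor))
          -- Under `In` the variable carries the renamed type, which is the type of the renamed
          -- polynomial `P′`.
          (⊢-≡ (trans (lookup-raiseᴵ In _ zero) (cong `∀ (renT-type ξ P)))
            (var (raiseᴵ In zero)))))
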